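{- Let $d\in\mathbb{N}$ and let $G$ be a graph on $n\geq 3$ vertices whose average degree is at most $d$. Then the degree sequence of $G$ can be reconstructed from its deck when at most $\frac{n}{10^4 d^3}$ of the cards are missing. That is, for every sub-multiset $\mathcal{D}'\subseteq\mathcal{D}(G)$ with $|\mathcal{D}'|\geq n-\frac{n}{10^4d^3}$, every graph $H$ on $n$ vertices with $\mathcal{D}'\subseteq\mathcal{D}(H)$ (as multisets) has the same degree sequence as $G$.
   Context: All graphs are finite, simple and undirected. For a vertex $v$ of a graph $G$, the card $G-v$ is the graph obtained by deleting $v$ and all incident edges. The deck $\mathcal{D}(G)$ is the multiset of the isomorphism classes (unlabelled versions) of the cards $G-v$, $v\in V(G)$. A parameter is reconstructible from a collection of cards if it is determined by that collection, in the sense that every graph on the same number of vertices whose deck contains that collection has the same value of the parameter. -}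

module Defs where

open import Data.Nat using (ℕ; zero; suc; _+_; _*_; _∸_; _^_; _≤_)
open import Data.Bool using (Bool; true; false; if_then_else_)
open import Data.Fin using (Fin; punchIn)
open import Data.Fin.Subset using (Subset; _∈_; ∣_∣)
open import Data.List using (List; map; allFin)
open import Data.Nat.ListAction using (sum)
open import Data.List.Relation.Binary.Permutation.Propositional using (_↭_)
open import Data.Product using (Σ; ∃; _×_; _,_)
open import Function.Bundles using (_↔_; Inverse)
open import Relation.Binary.PropositionalEquality using (_≡_)

record Graph (n : ℕ) : Set where
  field
    adj    : Fin n → Fin n → Bool
    sym    : ∀ i j → adj i j ≡ adj j i
    irrefl : ∀ i → adj i i ≡ false
open Graph public

deg : ∀ {n} → Graph n → Fin n → ℕ
deg {n} G i = sum (map (λ j → if adj G i j then 1 else 0) (allFin n))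

degSum : ∀ {n} → Graph n → ℕ
degSum {n} G = sum (map (deg G) (allFin n))

degSeq : ∀ {n} → Graph n → List ℕ
degSeq {n} G = map (deg G) (allFin n)

SameDegreeSequence : ∀ {n} → Graph n → Graph n → Set
SameDegreeSequence G H = degSeq G ↭ degSeq H

card : ∀ {m} → Graph (suc m) → Fin (suc m) → Graph m
card G v = record
  { adj    = λ i j → adj G (punchIn v i) (punchIn v j)
  ; sym    = λ i j → sym G (punchIn v i) (punchIn v j)
  ; irrefl = λ i → irrefl G (punchIn v i)
  }

_≅_ : ∀ {m} → Graph m → Graph m → Set
_≅_ {m} G H = Σ (Fin m ↔ Fin m) λ σ →
  ∀ i j → adj H (Inverse.to σ i) (Inverse.to σ j) ≡ adj G i j

-- A sub-multiset D' of the deck of G is given by a set S of vertices of G: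
-- D' = { G - v : v ∈ S } (as a multiset). D' ⊆ D(H) as multisets of
-- isomorphism classes means there is an injective assignment of a vertex of H
-- to each v ∈ S whose card in H is isomorphic to G - v.
SubDeckIncluded : ∀ {m} → Graph (suc m) → Subset (suc m) → Graph (suc m) → Set
SubDeckIncluded {m} G S H = Σ (Fin (suc m) → Fin (suc m)) λ f →
  (∀ v w → v ∈ S → w ∈ S → f v ≡ f w → v ≡ w) ×
  (∀ v → v ∈ S → card G v ≅ card H (f v))

{-# OPTIONS --safe #-}
module Submission where

-- Let k cards be missing; relabel H so that each known card is G - v ≅ H - v. If
-- degSum G < degSum H, then
-- all known degrees are shifted up by the same c ≥ 1, while deleting a low vertex hardly
-- changes the number A(j) of vertices of degree < j; so A(j + 1) ≤ A(j) + O(d + k), and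
-- at most O(d (d + k)) vertices have degree ≤ 2d, which is too few. Hence the degree sums,
-- and with them the known degrees, agree.
--
-- Comparing the numbers of vertices of degree ≥ j in the cards at a known v gives
--   Δ(j) = N_G(j, v) − N_H(j, v),   Δ(j) = #{deg_G ≥ j} − #{deg_H ≥ j},
-- where N(j, v) counts the neighbours of v of degree j. Suppose Δ(j + 1) = 0 and
-- Δ(j) > 0. Summing over v gives (n − j − k) Δ(j) ≤ k h with h = #{deg_H = j} ≤ dn / j,
-- so j is either close to n or at most 4dk. The first case is refuted by the identity at
-- j − 1. In the second, the number of pairs a ~ b with deg a = j and deg b < 4d is larger
-- in G than in H by a linear amount, yet it is almost unchanged when a low vertex is deleted.

open import Defs renaming (sym to adj-sym)
open import Data.Nat using (ℕ; zero; suc; _+_; _*_; _∸_; _^_; _≤_; _<_; z≤n; s≤s; _≤?_; _<?_; _≟_; NonZero; >-nonZero)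
open import Data.Fin.Subset using (Subset; _∈_; ∣_∣)
open import Data.Nat.Properties
open import Data.Nat.Tactic.RingSolver using (solve-∀)
import Data.Nat.ListAction as ListAction
open import Data.Nat.ListAction.Properties using (sum-↭)
open import Algebra.Properties.Semiring.Sum +-*-semiring
  using (sum; sum-syntax; sum-cong-≗; ∑-distrib-+; ∑-comm; sum-permute; *-distribˡ-sum; *-distribʳ-sum)
open import Data.Bool using (Bool; true; false; if_then_else_)
open import Data.Empty using (⊥)
open import Data.Fin using (Fin; zero; suc; punchIn; punchOut)
import Data.Fin as Fin
open import Data.Fin.Properties using (any?; punchIn-punchOut)
open import Data.Fin.Permutation using (Permutation; _⟨$⟩ʳ_; _⟨$⟩ˡ_; inverseˡ; inverseʳ; flip; transpose; insert; insert-punchIn; _∘ₚ_)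
import Data.Fin.Permutation as Perm
open import Data.Fin.Subset.Properties using (_∈?_)
open import Data.List using (List; []; _∷_; map; allFin; tabulate; _++_)
open import Data.List.Properties using (map-tabulate; map-∘)
open import Data.List.Membership.Propositional using () renaming (_∈_ to _∈ₗ_)
open import Data.List.Membership.Propositional.Properties using (∈-∃++; ∈-allFin)
open import Data.List.Relation.Unary.Any using (here; there)
open import Data.List.Relation.Binary.Permutation.Propositional using (_↭_; ↭-refl; ↭-sym; ↭-trans; prep)
open import Data.List.Relation.Binary.Permutation.Propositional.Properties using (shift; map⁺)
open import Data.Product using (_×_; _,_; ∃)
open import Data.Sum using (inj₁; inj₂)
open import Data.Vec using ([]; _∷_; lookup)
open import Data.Vec.Properties using (lookup⇒[]=)
open import Function using (_∘_)
open import Relation.Binary.Definitions using (tri<; tri≈; tri>)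
open import Relation.Binary.PropositionalEquality
open import Relation.Nullary using (Dec; yes; no; does; ¬_; contradiction)
open import Relation.Nullary.Decidable using (True; toWitness; _×-dec_; dec-true; dec-false)

-- Sums, indicators and the permutations realising equal cards

bit : Bool → ℕ
bit x = if x then 1 else 0

𝟙 : {P : Set} → Dec P → ℕ
𝟙 p = bit (does p)

module _ {P : Set} where

  𝟙-yes : (p : Dec P) → P → 𝟙 p ≡ 1
  𝟙-yes (yes _) _ = refl
  𝟙-yes (no ¬x) x = contradiction x ¬x

  𝟙-no : (p : Dec P) → ¬ P → 𝟙 p ≡ 0
  𝟙-no (yes x) ¬x = contradiction x ¬x
  𝟙-no (no _) _ = refl

  𝟙≤ : (p : Dec P) {x : ℕ} → (P → 1 ≤ x) → 𝟙 p ≤ x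
  𝟙≤ (yes x) h = h x
  𝟙≤ (no _) h = z≤n

sum-mono : ∀ {n} {f g : Fin n → ℕ} → (∀ i → f i ≤ g i) → sum f ≤ sum g
sum-mono {zero} h = z≤n
sum-mono {suc n} h = +-mono-≤ (h zero) (sum-mono (h ∘ suc))

sum-const : ∀ n c → ∑[ i < n ] c ≡ n * c
sum-const zero c = refl
sum-const (suc n) c = cong (c +_) (sum-const n c)

sum-δ : ∀ {n} (v : Fin n) (f : Fin n → ℕ) → ∑[ i < n ] (𝟙 (i Fin.≟ v) * f i) ≡ f v
sum-δ {suc n} zero f = begin
  f zero + 0 + ∑[ i < n ] 0 ≡⟨ cong (f zero + 0 +_) (trans (sum-const n 0) (*-zeroʳ n)) ⟩
  f zero + 0 + 0            ≡⟨ trans (+-identityʳ _) (+-identityʳ _) ⟩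
  f zero                    ∎
  where open ≡-Reasoning
sum-δ (suc v) f = sum-δ v (f ∘ suc)

sum-map-allFin : ∀ {n} (f : Fin n → ℕ) → ListAction.sum (map f (allFin n)) ≡ sum f
sum-map-allFin {n} f = trans (cong ListAction.sum (map-tabulate {n = n} (λ i → i) f)) (go f)
  where
  go : ∀ {n} (f : Fin n → ℕ) → ListAction.sum (tabulate f) ≡ sum f
  go {zero} f = refl
  go {suc n} f = cong (f zero +_) (go (f ∘ suc))

module _ {n : ℕ} where

  e : Graph n → Fin n → Fin n → ℕ
  e G a b = bit (adj G a b)

  e-sym : ∀ G a b → e G a b ≡ e G b a
  e-sym G a b = cong bit (adj-sym G a b)

  e-irrefl : ∀ G a → e G a a ≡ 0
  e-irrefl G a = cong bit (irrefl G a)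

  e≤1 : ∀ G a b → e G a b ≤ 1
  e≤1 G a b with adj G a b
  ... | true = ≤-refl
  ... | false = z≤n

  deg≡∑ : ∀ G a → deg G a ≡ sum (e G a)
  deg≡∑ G a = sum-map-allFin (e G a)

  degSum≡∑ : ∀ (G : Graph n) → degSum G ≡ sum (deg G)
  degSum≡∑ G = sum-map-allFin (deg G)

  deg≤n : ∀ G a → deg G a ≤ n
  deg≤n G a = begin
    deg G a      ≡⟨ deg≡∑ G a ⟩
    sum (e G a)  ≤⟨ sum-mono (e≤1 G a) ⟩
    ∑[ i < n ] 1 ≡⟨ sum-const n 1 ⟩
    n * 1        ≡⟨ *-identityʳ n ⟩
    n            ∎
    where open ≤-Reasoning

  -- Double counting: the weight of `a` is collected once by each of its `deg G a` neighbours.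
  ∑∑-e : ∀ G (w : Fin n → ℕ) → ∑[ b < n ] ∑[ a < n ] (e G a b * w a) ≡ ∑[ a < n ] (deg G a * w a)
  ∑∑-e G w = begin
    ∑[ b < n ] ∑[ a < n ] (e G a b * w a) ≡⟨ ∑-comm (λ b a → e G a b * w a) ⟩
    ∑[ a < n ] ∑[ b < n ] (e G a b * w a) ≡⟨ sum-cong-≗ (λ a → sym (*-distribʳ-sum (w a) (e G a))) ⟩
    ∑[ a < n ] (sum (e G a) * w a)        ≡⟨ sum-cong-≗ (λ a → cong (_* w a) (sym (deg≡∑ G a))) ⟩
    ∑[ a < n ] (deg G a * w a)            ∎
    where open ≡-Reasoning

  -- G - v ≅ H - v, as a permutation of all the vertices that fixes v.
  record SameCard (G H : Graph n) (v : Fin n) : Set where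
    field
      τ      : Permutation n n
      fixes  : τ ⟨$⟩ʳ v ≡ v
      e-iso  : ∀ {a b} → a ≢ v → b ≢ v → e H (τ ⟨$⟩ʳ a) (τ ⟨$⟩ʳ b) ≡ e G a b

  SameCard-sym : ∀ {G H v} → SameCard G H v → SameCard H G v
  SameCard-sym {G} {H} {v} s = record
    { τ     = flip τ
    ; fixes = trans (cong (τ ⟨$⟩ˡ_) (sym fixes)) (inverseˡ τ)
    ; e-iso = λ a≢v b≢v → trans (sym (e-iso (≢v a≢v) (≢v b≢v))) (cong₂ (e H) (inverseʳ τ) (inverseʳ τ))
    }
    where
    open SameCard s
    ≢v : ∀ {a} → a ≢ v → τ ⟨$⟩ˡ a ≢ v
    ≢v a≢v eq = a≢v (trans (sym (inverseʳ τ)) (trans (cong (τ ⟨$⟩ʳ_) eq) fixes))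

  module CardIdentities {G H : Graph n} {v : Fin n} (s : SameCard G H v) where
    open SameCard s public
    open ≡-Reasoning

    t : Fin n → Fin n
    t = τ ⟨$⟩ʳ_

    -- Both sides moved: deg a − [a ~ v] is the degree of a in the card.
    deg-card : ∀ {a} → a ≢ v → deg H (t a) + e G a v ≡ deg G a + e H (t a) v
    deg-card {a} a≢v = begin
      deg H (t a) + e G a v
        ≡⟨ cong₂ _+_ (trans (deg≡∑ H (t a)) (sum-permute (e H (t a)) τ)) (sym (sum-δ v (λ _ → e G a v))) ⟩
      ∑[ b < n ] e H (t a) (t b) + ∑[ b < n ] (𝟙 (b Fin.≟ v) * e G a v)
        ≡⟨ sym (∑-distrib-+ (λ b → e H (t a) (t b)) _) ⟩
      ∑[ b < n ] (e H (t a) (t b) + 𝟙 (b Fin.≟ v) * e G a v)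
        ≡⟨ sum-cong-≗ pointwise ⟩
      ∑[ b < n ] (e G a b + 𝟙 (b Fin.≟ v) * e H (t a) v)
        ≡⟨ ∑-distrib-+ (e G a) _ ⟩
      sum (e G a) + ∑[ b < n ] (𝟙 (b Fin.≟ v) * e H (t a) v)
        ≡⟨ cong₂ _+_ (sym (deg≡∑ G a)) (sum-δ v (λ _ → e H (t a) v)) ⟩
      deg G a + e H (t a) v ∎
      where
      pointwise : ∀ b → e H (t a) (t b) + 𝟙 (b Fin.≟ v) * e G a v ≡ e G a b + 𝟙 (b Fin.≟ v) * e H (t a) v
      pointwise b with b Fin.≟ v
      -- At `b = v` the edges to `v` are outside the reach of `e-iso`; the two correction terms
      -- supply exactly these edges, in opposite order.
      ... | yes refl rewrite fixes = trans (+-comm (e H (t a) v) _) (cong₂ _+_ (+-identityʳ (e G a v)) (sym (+-identityʳ (e H (t a) v))))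
      ... | no b≢v = cong (_+ 0) (e-iso a≢v b≢v)

    -- The degree sum of a card is `degSum G` minus twice `deg G v`, so the difference of the degree
    -- sums fixes the difference of the degrees at `v`. One copy of `deg G v` comes from summing
    -- `deg-card`, the other fills in the term `a = v`, which that lemma leaves out.
    degSum-card : degSum H + 2 * deg G v ≡ degSum G + 2 * deg H v
    degSum-card = begin
      degSum H + 2 * deg G v
        ≡⟨ arith₁ (degSum H) (deg G v) ⟩
      degSum H + deg G v + deg G v
        ≡⟨ cong₂ _+_ (cong₂ _+_ (trans (degSum≡∑ H) (sum-permute (deg H) τ)) (trans (deg≡∑ G v) (sum-cong-≗ (e-sym G v))))
                     (sym (sum-δ v (λ _ → deg G v))) ⟩
      ∑[ a < n ] deg H (t a) + ∑[ a < n ] e G a v + ∑[ a < n ] (𝟙 (a Fin.≟ v) * deg G v)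
        ≡⟨ sym (trans (∑-distrib-+ (λ a → deg H (t a) + e G a v) _) (cong (_+ _) (∑-distrib-+ (deg H ∘ t) _))) ⟩
      ∑[ a < n ] (deg H (t a) + e G a v + 𝟙 (a Fin.≟ v) * deg G v)
        ≡⟨ sum-cong-≗ pointwise ⟩
      ∑[ a < n ] (deg G a + e H (t a) v + 𝟙 (a Fin.≟ v) * deg H v)
        ≡⟨ trans (∑-distrib-+ (λ a → deg G a + e H (t a) v) _) (cong (_+ _) (∑-distrib-+ (deg G) _)) ⟩
      sum (deg G) + ∑[ a < n ] e H (t a) v + ∑[ a < n ] (𝟙 (a Fin.≟ v) * deg H v)
        ≡⟨ cong₂ _+_ (cong₂ _+_ (sym (degSum≡∑ G))
                       (trans (sym (sum-permute (λ a → e H a v) τ)) (trans (sum-cong-≗ (λ a → e-sym H a v)) (sym (deg≡∑ H v)))))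
                     (sum-δ v (λ _ → deg H v)) ⟩
      degSum G + deg H v + deg H v
        ≡⟨ sym (arith₁ (degSum G) (deg H v)) ⟩
      degSum G + 2 * deg H v ∎
      where
      arith₁ : ∀ x y → x + 2 * y ≡ x + y + y
      arith₁ = solve-∀
      pointwise : ∀ a → deg H (t a) + e G a v + 𝟙 (a Fin.≟ v) * deg G v ≡ deg G a + e H (t a) v + 𝟙 (a Fin.≟ v) * deg H v
      pointwise a with a Fin.≟ v
      ... | yes refl rewrite fixes | e-irrefl G v | e-irrefl H v = arith₂ (deg H v) (deg G v)
        where
        arith₂ : ∀ x y → x + 0 + 1 * y ≡ y + 0 + 1 * x
        arith₂ = solve-∀
      ... | no a≢v = cong (_+ 0) (deg-card a≢v)

-- Numerical estimates

module Bounds (d k n C : ℕ) (1≤d : 1 ≤ d) (1≤k : 1 ≤ k) (200≤C : 200 ≤ C)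
              (C*K≤n : C * (d * d * d * k) ≤ n) where
  open ≤-Reasoning

  private
    instance
      d≢0 : NonZero d
      d≢0 = >-nonZero 1≤d
      k≢0 : NonZero k
      k≢0 = >-nonZero 1≤k

  K : ℕ
  K = d * d * d * k

  dk≤ddk : d * k ≤ d * d * k
  dk≤ddk = ≤-trans (m≤n*m (d * k) d) (≤-reflexive (sym (*-assoc d d k)))

  ddk≤K : d * d * k ≤ K
  ddk≤K = *-monoˡ-≤ k (m≤m*n (d * d) d)

  k≤dk : k ≤ d * k
  k≤dk = m≤n*m k d

  d≤dk : d ≤ d * k
  d≤dk = m≤m*n d k

  1≤dk : 1 ≤ d * k
  1≤dk = ≤-trans 1≤k k≤dk

  dk≤K : d * k ≤ K
  dk≤K = ≤-trans dk≤ddk ddk≤K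

  instance
    K≢0 : NonZero K
    K≢0 = >-nonZero (≤-trans 1≤dk dk≤K)

  -- The estimates end in a numeral times `K`, the largest numeral being 140; the implicit `True`
  -- argument lets the type checker decide that the numeral is below 200.
  below : ∀ c {x} {_ : True (c <? 200)} → x ≤ c * K → x < n
  below c {x} {c<200} x≤cK = begin-strict
    x     ≤⟨ x≤cK ⟩
    c * K <⟨ *-monoˡ-< K (<-≤-trans (toWitness c<200) 200≤C) ⟩
    C * K ≤⟨ C*K≤n ⟩
    n     ∎

  absurd : ∀ c {_ : True (c <? 200)} → n ≤ c * K → ⊥
  absurd c {c<200} n≤cK = n≮n _ (below c {_} {c<200} n≤cK)

  n≢0 : NonZero n
  n≢0 = >-nonZero (≤-<-trans z≤n (below 0 {0} z≤n))

  -- In the estimates below, k is the number of missing cards, h is the number of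
  -- vertices of degree i or j in H, δ is the excess of G over H in the number of
  -- vertices of degree at least j, and F, F′ count the pairs a ~ b with deg a = j
  -- and deg b < 4 d in G and H.

  -- Refutes that all known vertices have degree above `2 * d`: cancelling `d * n` leaves
  -- `n + d * n ≤ k * suc (2 * d)`, and the right side is at most `3 * K`.
  low-vertex-bound : n * suc (2 * d) ≤ d * n + k * suc (2 * d) → ⊥
  low-vertex-bound h = absurd 3 (begin
    n                 ≤⟨ m≤m+n n (d * n) ⟩
    n + d * n         ≤⟨ +-cancelˡ-≤ (d * n) _ _ (≤-trans (≤-reflexive (p₁ n d)) h) ⟩
    k * suc (2 * d)   ≡⟨ p₂ k d ⟩
    k + 2 * (d * k)   ≤⟨ +-mono-≤ (≤-trans k≤dk dk≤K) (*-monoʳ-≤ 2 dk≤K) ⟩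
    3 * K             ∎)
    where
    p₁ : ∀ n d → d * n + (n + d * n) ≡ n * suc (2 * d)
    p₁ = solve-∀
    p₂ : ∀ k d → k * suc (2 * d) ≡ k + 2 * (d * k)
    p₂ = solve-∀

  -- After doubling the hypothesis, the error `(2 * k + 4) * c` is at most `n * c` and absorbs one
  -- of the two copies of `n * c`.
  shift-bound : ∀ {c} → n * c ≤ d * n + (k + 2) * c → c ≤ 2 * d
  shift-bound {c} h = *-cancelˡ-≤ n {{n≢0}} (+-cancelʳ-≤ (n * c) _ _ (begin
    n * c + n * c                 ≤⟨ +-mono-≤ h h ⟩
    d * n + (k + 2) * c + (d * n + (k + 2) * c) ≡⟨ p₁ d n k c ⟩
    n * (2 * d) + (2 * k + 4) * c ≤⟨ +-monoʳ-≤ _ (*-monoˡ-≤ c (<⇒≤ (below 6 k+2))) ⟩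
    n * (2 * d) + n * c           ∎))
    where
    p₁ : ∀ d n k c → d * n + (k + 2) * c + (d * n + (k + 2) * c) ≡ n * (2 * d) + (2 * k + 4) * c
    p₁ = solve-∀
    p₂ : ∀ K → 2 * K + 4 * K ≡ 6 * K
    p₂ = solve-∀
    k+2 : 2 * k + 4 ≤ 6 * K
    k+2 = begin
      2 * k + 4     ≤⟨ +-mono-≤ (*-monoʳ-≤ 2 (≤-trans k≤dk dk≤K)) (*-monoʳ-≤ 4 (≤-trans 1≤dk dk≤K)) ⟩
      2 * K + 4 * K ≡⟨ p₂ K ⟩
      6 * K         ∎

  1+2d≤3d : suc (2 * d) ≤ 3 * d
  1+2d≤3d = +-monoˡ-≤ (2 * d) 1≤d

  -- `A` is the number of vertices of degree at most `2 * d`. The average degree forces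
  -- `n ≤ suc (2 * d) * A`; with the upper bound on `A`, three factors of order `d` meet, and this
  -- is the one estimate of full order d³k.
  few-low-bound : ∀ {A} → n * suc (2 * d) ≤ suc (2 * d) * A + d * n →
                  A ≤ suc (2 * d) * (k + suc (4 * d)) → ⊥
  few-low-bound {A} h A≤ = absurd 54 (begin
    n                                                 ≤⟨ m≤m+n n (d * n) ⟩
    n + d * n                                         ≤⟨ +-cancelʳ-≤ (d * n) _ _ (≤-trans (≤-reflexive (p₁ n d)) h) ⟩
    suc (2 * d) * A                                   ≤⟨ *-monoʳ-≤ (suc (2 * d)) A≤ ⟩
    suc (2 * d) * (suc (2 * d) * (k + suc (4 * d)))   ≤⟨ *-mono-≤ 1+2d≤3d (*-mono-≤ 1+2d≤3d (+-mono-≤ k≤dk (+-mono-≤ 1≤dk (*-monoʳ-≤ 4 d≤dk)))) ⟩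
    3 * d * (3 * d * (d * k + (d * k + 4 * (d * k)))) ≡⟨ p₂ d k ⟩
    54 * K                                            ∎)
    where
    p₁ : ∀ n d → n + d * n + d * n ≡ n * suc (2 * d)
    p₁ = solve-∀
    p₂ : ∀ d k → 3 * d * (3 * d * (d * k + (d * k + 4 * (d * k)))) ≡ 54 * (d * d * d * k)
    p₂ = solve-∀

  at-most-2d : ∀ {i h} → n ≤ 2 * i → i * h ≤ d * n → h ≤ 2 * d
  at-most-2d {i} {h} n≤2i ih≤dn = *-cancelˡ-≤ n {{n≢0}} (begin
    n * h       ≤⟨ *-monoˡ-≤ h n≤2i ⟩
    2 * i * h   ≡⟨ *-assoc 2 i h ⟩
    2 * (i * h) ≤⟨ *-monoʳ-≤ 2 ih≤dn ⟩
    2 * (d * n) ≡⟨ p d n ⟩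
    n * (2 * d) ∎)
    where
    p : ∀ d n → 2 * (d * n) ≡ n * (2 * d)
    p = solve-∀

  -- Cancelling `i * h` leaves `n ≤ r * h + k * suc h`. As `i` is at least n/2, `h ≤ 2 * d`; the
  -- factor 20 then makes `r * h` at most n/10, and the rest is at most `3 * K`.
  near-top : ∀ {i r h} → i + r ≡ n → 20 * d * r ≤ n →
             n + i * h ≤ n * h + k * suc h → i * h ≤ d * n → ⊥
  near-top {i} {r} {h} i+r≡n 20dr≤n bound ih≤dn = absurd 30 (begin
    n     ≤⟨ m≤n*m n 9 ⟩
    9 * n ≤⟨ +-cancelʳ-≤ n _ _ 10n≤ ⟩
    30 * K ∎)
    where
    2r≤20dr : 2 * r ≤ 20 * d * r
    2r≤20dr = *-monoˡ-≤ r (≤-trans (m≤n*m 2 10) (*-monoʳ-≤ 20 1≤d))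
    n≤2i : n ≤ 2 * i
    n≤2i = +-cancelʳ-≤ n _ _ (begin
      n + n         ≡⟨ cong₂ _+_ (sym i+r≡n) (sym i+r≡n) ⟩
      i + r + (i + r) ≡⟨ p i r ⟩
      2 * i + 2 * r ≤⟨ +-monoʳ-≤ (2 * i) (≤-trans 2r≤20dr 20dr≤n) ⟩
      2 * i + n     ∎)
      where
      p : ∀ i r → i + r + (i + r) ≡ 2 * i + 2 * r
      p = solve-∀
    h≤2d : h ≤ 2 * d
    h≤2d = at-most-2d {i} n≤2i ih≤dn
    n≤ : n ≤ r * (2 * d) + k * suc (2 * d)
    n≤ = begin
      n                           ≤⟨ +-cancelʳ-≤ (i * h) _ _ (≤-trans bound (≤-reflexive (trans (cong (λ x → x * h + k * suc h) (sym i+r≡n)) (p i r h k)))) ⟩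
      r * h + k * suc h           ≤⟨ +-mono-≤ (*-monoʳ-≤ r h≤2d) (*-monoʳ-≤ k (s≤s h≤2d)) ⟩
      r * (2 * d) + k * suc (2 * d) ∎
      where
      p : ∀ i r h k → (i + r) * h + k * suc h ≡ r * h + k * suc h + i * h
      p = solve-∀
    10n≤ : 9 * n + n ≤ 30 * K + n
    10n≤ = begin
      9 * n + n                            ≡⟨ p₁ n ⟩
      10 * n                               ≤⟨ *-monoʳ-≤ 10 n≤ ⟩
      10 * (r * (2 * d) + k * suc (2 * d)) ≤⟨ *-monoʳ-≤ 10 (+-monoʳ-≤ (r * (2 * d)) (*-monoʳ-≤ k 1+2d≤3d)) ⟩
      10 * (r * (2 * d) + k * (3 * d))     ≡⟨ p₂ d r k ⟩
      30 * (d * k) + 20 * d * r            ≤⟨ +-mono-≤ (*-monoʳ-≤ 30 dk≤K) 20dr≤n ⟩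
      30 * K + n                           ∎
      where
      p₁ : ∀ n → 9 * n + n ≡ 10 * n
      p₁ = solve-∀
      p₂ : ∀ d r k → 10 * (r * (2 * d) + k * (3 * d)) ≡ 30 * (d * k) + 20 * d * r
      p₂ = solve-∀

  -- The hypothesis says `r * δ ≤ k * δ + k * h`. The lower bound on `r` gives `2 * k ≤ r`, so after
  -- doubling, the term in `k * δ` is absorbed by one copy of `r * δ`.
  gap-bound : ∀ {j r h δ} → 1 ≤ δ → j + r ≡ n → n < 20 * d * suc r →
              n * δ ≤ j * δ + k * δ + k * h → r ≤ 2 * (k * h)
  gap-bound {j} {r} {h} {δ} 1≤δ j+r≡n n<20d1+r bound = begin
    r             ≤⟨ m≤m*n r δ {{>-nonZero 1≤δ}} ⟩
    r * δ         ≤⟨ +-cancelʳ-≤ (r * δ) _ _ 2rδ≤ ⟩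
    2 * (k * h)   ∎
    where
    2k≤r : 2 * k ≤ r
    2k≤r = ≤-pred (<⇒≤ (*-cancelˡ-< (20 * d) _ _ (begin-strict
      20 * d * suc (2 * k)         ≤⟨ *-monoʳ-≤ (20 * d) (+-monoˡ-≤ (2 * k) 1≤k) ⟩
      20 * d * (k + 2 * k)         ≡⟨ p d k ⟩
      60 * (d * k)                 <⟨ below 60 (*-monoʳ-≤ 60 dk≤K) ⟩
      n                            <⟨ n<20d1+r ⟩
      20 * d * suc r               ∎)))
      where
      p : ∀ d k → 20 * d * (k + 2 * k) ≡ 60 * (d * k)
      p = solve-∀
    rδ≤ : r * δ ≤ k * δ + k * h
    rδ≤ = +-cancelˡ-≤ (j * δ) _ _ (begin
      j * δ + r * δ           ≡⟨ sym (*-distribʳ-+ δ j r) ⟩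
      (j + r) * δ             ≡⟨ cong (_* δ) j+r≡n ⟩
      n * δ                   ≤⟨ bound ⟩
      j * δ + k * δ + k * h   ≡⟨ +-assoc (j * δ) _ _ ⟩
      j * δ + (k * δ + k * h) ∎)
    2rδ≤ : r * δ + r * δ ≤ 2 * (k * h) + r * δ
    2rδ≤ = begin
      r * δ + r * δ                       ≤⟨ +-mono-≤ rδ≤ rδ≤ ⟩
      k * δ + k * h + (k * δ + k * h)     ≡⟨ p k δ h ⟩
      2 * (k * h) + 2 * k * δ             ≤⟨ +-monoʳ-≤ (2 * (k * h)) (*-monoˡ-≤ δ 2k≤r) ⟩
      2 * (k * h) + r * δ                 ∎
      where
      p : ∀ k δ h → k * δ + k * h + (k * δ + k * h) ≡ 2 * (k * h) + 2 * k * δ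
      p = solve-∀

  -- If `j` is at least n/2, then `h ≤ 2 * d`, so `r` is too small for `n < 20 * d * suc r`.
  -- Otherwise `n ≤ 2 * r ≤ 4 * (k * h)`, and multiplying by `j` brings in `j * h ≤ d * n`.
  far-from-top : ∀ {j r h} → j + r ≡ n → n < 20 * d * suc r →
                 r ≤ 2 * (k * h) → j * h ≤ d * n → j ≤ 4 * (d * k)
  far-from-top {j} {r} {h} j+r≡n n<20d1+r r≤2kh jh≤dn with n ≤? 2 * j
  ... | yes n≤2j = contradiction n<20d1+r (<⇒≯ (below 100 (begin
    20 * d * suc r                 ≤⟨ *-monoʳ-≤ (20 * d) (+-mono-≤ 1≤dk r≤4dk) ⟩
    20 * d * (d * k + 4 * (d * k)) ≡⟨ p₁ d k ⟩
    100 * (d * d * k)              ≤⟨ *-monoʳ-≤ 100 ddk≤K ⟩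
    100 * K                        ∎)))
    where
    p₁ : ∀ d k → 20 * d * (d * k + 4 * (d * k)) ≡ 100 * (d * d * k)
    p₁ = solve-∀
    p₂ : ∀ d k → 2 * (k * (2 * d)) ≡ 4 * (d * k)
    p₂ = solve-∀
    r≤4dk : r ≤ 4 * (d * k)
    r≤4dk = begin
      r                 ≤⟨ r≤2kh ⟩
      2 * (k * h)       ≤⟨ *-monoʳ-≤ 2 (*-monoʳ-≤ k (at-most-2d {j} n≤2j jh≤dn)) ⟩
      2 * (k * (2 * d)) ≡⟨ p₂ d k ⟩
      4 * (d * k)       ∎
  ... | no n≰2j = *-cancelˡ-≤ n {{n≢0}} (begin
    n * j                 ≤⟨ *-monoˡ-≤ j n≤2r ⟩
    2 * r * j             ≤⟨ *-monoˡ-≤ j (*-monoʳ-≤ 2 r≤2kh) ⟩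
    2 * (2 * (k * h)) * j ≡⟨ p₁ k h j ⟩
    4 * k * (j * h)       ≤⟨ *-monoʳ-≤ (4 * k) jh≤dn ⟩
    4 * k * (d * n)       ≡⟨ p₂ k d n ⟩
    n * (4 * (d * k))     ∎)
    where
    p₁ : ∀ k h j → 2 * (2 * (k * h)) * j ≡ 4 * k * (j * h)
    p₁ = solve-∀
    p₂ : ∀ k d n → 4 * k * (d * n) ≡ n * (4 * (d * k))
    p₂ = solve-∀
    p₃ : ∀ j r → j + r + (j + r) ≡ 2 * r + 2 * j
    p₃ = solve-∀
    n≤2r : n ≤ 2 * r
    n≤2r = +-cancelʳ-≤ n _ _ (begin
      n + n           ≡⟨ cong₂ _+_ (sym j+r≡n) (sym j+r≡n) ⟩
      j + r + (j + r) ≡⟨ p₃ j r ⟩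
      2 * r + 2 * j   ≤⟨ +-monoʳ-≤ (2 * r) (<⇒≤ (≰⇒> n≰2j)) ⟩
      2 * r + n       ∎)

  -- `D` is the degree of a known low vertex and `Hi` the number of vertices of degree at least
  -- `4 * d`. Together the two comparisons of `F` and `F′` give `n ≤ 35 * K + Hi`, and `Hi` is at
  -- most n/4.
  low-bound : ∀ {F F′ Hi D j} → j ≤ 4 * (d * k) → D ≤ 2 * d → 4 * Hi ≤ n →
              F′ + n ≤ F + k * suc (4 * d) + Hi → F ≤ F′ + D * (2 * j + 4 * d + 3) → ⊥
  low-bound {F} {F′} {Hi} {D} {j} j≤ D≤ 4Hi≤n h₁ h₂ = absurd 140 (begin
    n     ≤⟨ m≤n*m n 3 ⟩
    3 * n ≤⟨ +-cancelʳ-≤ n _ _ 4n≤ ⟩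
    140 * K ∎)
    where
    n≤ : n ≤ D * (2 * j + 4 * d + 3) + k * suc (4 * d) + Hi
    n≤ = +-cancelˡ-≤ F′ _ _ (begin
      F′ + n                                                        ≤⟨ h₁ ⟩
      F + k * suc (4 * d) + Hi                                      ≤⟨ +-monoˡ-≤ Hi (+-monoˡ-≤ (k * suc (4 * d)) h₂) ⟩
      F′ + D * (2 * j + 4 * d + 3) + k * suc (4 * d) + Hi           ≡⟨ p F′ (D * (2 * j + 4 * d + 3)) (k * suc (4 * d)) Hi ⟩
      F′ + (D * (2 * j + 4 * d + 3) + k * suc (4 * d) + Hi)         ∎)
      where
      p : ∀ a b c d → a + b + c + d ≡ a + (b + c + d)
      p = solve-∀
    ddk : D * (2 * j + 4 * d + 3) + k * suc (4 * d) ≤ 35 * K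
    ddk = begin
      D * (2 * j + 4 * d + 3) + k * suc (4 * d)
        ≤⟨ +-mono-≤ (*-mono-≤ D≤ (+-mono-≤ (+-mono-≤ (*-monoʳ-≤ 2 j≤) (*-monoʳ-≤ 4 d≤dk)) (*-monoʳ-≤ 3 1≤dk)))
                    (*-monoʳ-≤ k (+-monoˡ-≤ (4 * d) 1≤d)) ⟩
      2 * d * (2 * (4 * (d * k)) + 4 * (d * k) + 3 * (d * k)) + k * (d + 4 * d)
        ≡⟨ p₁ d k ⟩
      30 * (d * d * k) + 5 * (d * k)
        ≤⟨ +-mono-≤ (*-monoʳ-≤ 30 ddk≤K) (*-monoʳ-≤ 5 dk≤K) ⟩
      30 * K + 5 * K
        ≡⟨ p₂ K ⟩
      35 * K ∎
      where
      p₁ : ∀ d k → 2 * d * (2 * (4 * (d * k)) + 4 * (d * k) + 3 * (d * k)) + k * (d + 4 * d) ≡ 30 * (d * d * k) + 5 * (d * k)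
      p₁ = solve-∀
      p₂ : ∀ K → 30 * K + 5 * K ≡ 35 * K
      p₂ = solve-∀
    4n≤ : 3 * n + n ≤ 140 * K + n
    4n≤ = begin
      3 * n + n                ≡⟨ p₁ n ⟩
      4 * n                    ≤⟨ *-monoʳ-≤ 4 (≤-trans n≤ (+-monoˡ-≤ Hi ddk)) ⟩
      4 * (35 * K + Hi)        ≡⟨ p₂ K Hi ⟩
      140 * K + 4 * Hi         ≤⟨ +-monoʳ-≤ (140 * K) 4Hi≤n ⟩
      140 * K + n              ∎
      where
      p₁ : ∀ n → 3 * n + n ≡ 4 * n
      p₁ = solve-∀
      p₂ : ∀ K Hi → 4 * (35 * K + Hi) ≡ 140 * K + 4 * Hi
      p₂ = solve-∀

-- Counting vertices and edges by degree

𝟙*≤ : {P : Set} (p : Dec P) {x c : ℕ} → (P → x ≤ c) → 𝟙 p * x ≤ c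
𝟙*≤ (yes a) {x} h = ≤-trans (≤-reflexive (*-identityˡ x)) (h a)
𝟙*≤ (no _) h = z≤n

*𝟙≤ : {P : Set} (p : Dec P) {x c : ℕ} → (P → x ≤ c) → x * 𝟙 p ≤ c
*𝟙≤ p {x} h = ≤-trans (≤-reflexive (*-comm x (𝟙 p))) (𝟙*≤ p h)

𝟙*𝟙≤ : {P Q : Set} (p : Dec P) (q : Dec Q) {x : ℕ} → (P → Q → 1 ≤ x) → 𝟙 p * 𝟙 q ≤ x
𝟙*𝟙≤ p q h = 𝟙*≤ p (λ a → 𝟙≤ q (h a))

*𝟙-cong : {P : Set} (p : Dec P) {x y : ℕ} → (P → x ≡ y) → x * 𝟙 p ≡ y * 𝟙 p
*𝟙-cong (yes a) h = cong (_* 1) (h a)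
*𝟙-cong (no _) {x} {y} h = trans (*-zeroʳ x) (sym (*-zeroʳ y))

𝟙-suc-≥ : ∀ j p → 𝟙 (j ≤? suc p) ≡ 𝟙 (j ≤? p) + 𝟙 (suc p ≟ j)
𝟙-suc-≥ j p with <-cmp (suc p) j
... | tri< sp<j sp≢j _ = trans (𝟙-no (j ≤? suc p) (<⇒≱ sp<j))
        (sym (cong₂ _+_ (𝟙-no (j ≤? p) (λ j≤p → <⇒≱ sp<j (m≤n⇒m≤1+n j≤p))) (𝟙-no (suc p ≟ j) sp≢j)))
... | tri≈ _ refl _ = trans (𝟙-yes (suc p ≤? suc p) ≤-refl)
        (sym (cong₂ _+_ (𝟙-no (suc p ≤? p) 1+n≰n) (𝟙-yes (suc p ≟ suc p) refl)))
... | tri> _ sp≢j j<sp = trans (𝟙-yes (j ≤? suc p) (<⇒≤ j<sp))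
        (sym (cong₂ _+_ (𝟙-yes (j ≤? p) (≤-pred j<sp)) (𝟙-no (suc p ≟ j) sp≢j)))

-- `p` and `q` are the degrees of one vertex in G and H, and `x` and `y` tell whether it is adjacent
-- to `v` there. The degrees differ by at most one, so exactly one of them reaches `j` only if the
-- larger equals `j`.
𝟙-≥-card : ∀ j p q x y → q + bit x ≡ p + bit y →
           𝟙 (j ≤? p) + bit y * 𝟙 (q ≟ j) ≡ 𝟙 (j ≤? q) + bit x * 𝟙 (p ≟ j)
𝟙-≥-card j p q true true eq with refl ← +-cancelʳ-≡ 1 q p eq = refl
𝟙-≥-card j p q false false eq with refl ← +-cancelʳ-≡ 0 q p eq = refl
𝟙-≥-card j p q true false eq with refl ← trans (sym (+-comm q 1)) (trans eq (+-identityʳ p)) =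
  trans (+-identityʳ _) (trans (𝟙-suc-≥ j q) (cong (𝟙 (j ≤? q) +_) (sym (*-identityˡ _))))
𝟙-≥-card j p q false true eq with refl ← trans (sym (+-comm p 1)) (trans (sym eq) (+-identityʳ q)) =
  sym (trans (+-identityʳ _) (trans (𝟙-suc-≥ j p) (cong (𝟙 (j ≤? p) +_) (sym (*-identityˡ _)))))

-- A vertex with `μ v` nonzero is charged `μ v * c ≥ c`. The error terms due to missing cards arise
-- this way.
sum-except : ∀ {n c} (μ : Fin n → ℕ) {f g : Fin n → ℕ} →
             (∀ v → μ v ≡ 0 → f v ≤ g v) → (∀ v → f v ≤ c) → sum f ≤ sum g + sum μ * c
sum-except {n} {c} μ {f} {g} present bounded = begin
  sum f                             ≤⟨ sum-mono pointwise ⟩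
  ∑[ v < n ] (g v + μ v * c)        ≡⟨ ∑-distrib-+ g _ ⟩
  sum g + ∑[ v < n ] (μ v * c)      ≡⟨ cong (sum g +_) (sym (*-distribʳ-sum c μ)) ⟩
  sum g + sum μ * c                 ∎
  where
  open ≤-Reasoning
  pointwise : ∀ v → f v ≤ g v + μ v * c
  pointwise v with μ v in eq
  ... | zero = ≤-trans (present v eq) (m≤m+n (g v) 0)
  ... | suc x = ≤-trans (bounded v) (≤-trans (m≤m+n c (x * c)) (m≤n+m _ (g v)))

module _ {n : ℕ} where

  deg≥ deg= deg< : Graph n → ℕ → ℕ
  deg≥ G j = ∑[ a < n ] 𝟙 (j ≤? deg G a)
  deg= G j = ∑[ a < n ] 𝟙 (deg G a ≟ j)
  deg< G j = ∑[ a < n ] 𝟙 (deg G a <? j)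

  N : Graph n → ℕ → Fin n → ℕ
  N G j v = ∑[ a < n ] (e G a v * 𝟙 (deg G a ≟ j))

  deg≥-suc : ∀ G j → deg≥ G j ≡ deg≥ G (suc j) + deg= G j
  deg≥-suc G j = trans (sum-cong-≗ (λ a → pointwise (deg G a))) (∑-distrib-+ (λ a → 𝟙 (suc j ≤? deg G a)) _)
    where
    pointwise : ∀ p → 𝟙 (j ≤? p) ≡ 𝟙 (suc j ≤? p) + 𝟙 (p ≟ j)
    pointwise p with <-cmp p j
    ... | tri< p<j p≢j _ = trans (𝟙-no (j ≤? p) (<⇒≱ p<j)) (sym (cong₂ _+_ (𝟙-no (suc j ≤? p) (<⇒≱ (m<n⇒m<1+n p<j))) (𝟙-no (p ≟ j) p≢j)))
    ... | tri≈ _ refl _ = trans (𝟙-yes (p ≤? p) ≤-refl) (sym (cong₂ _+_ (𝟙-no (suc p ≤? p) 1+n≰n) (𝟙-yes (p ≟ p) refl)))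
    ... | tri> _ p≢j j<p = trans (𝟙-yes (j ≤? p) (<⇒≤ j<p)) (sym (cong₂ _+_ (𝟙-yes (suc j ≤? p) j<p) (𝟙-no (p ≟ j) p≢j)))

  N≤deg= : ∀ G j v → N G j v ≤ deg= G j
  N≤deg= G j v = sum-mono (λ a → ≤-trans (*-monoˡ-≤ _ (e≤1 G a v)) (≤-reflexive (*-identityˡ _)))

  N≤deg : ∀ G j v → N G j v ≤ deg G v
  N≤deg G j v = begin
    N G j v              ≤⟨ sum-mono (λ a → *𝟙≤ (deg G a ≟ j) (λ _ → ≤-refl)) ⟩
    ∑[ a < n ] e G a v   ≡⟨ sum-cong-≗ (λ a → e-sym G a v) ⟩
    sum (e G v)          ≡⟨ sym (deg≡∑ G v) ⟩
    deg G v              ∎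
    where open ≤-Reasoning

  ∑N : ∀ G j → sum (N G j) ≡ j * deg= G j
  ∑N G j = begin
    sum (N G j)                               ≡⟨ ∑∑-e G (λ a → 𝟙 (deg G a ≟ j)) ⟩
    ∑[ a < n ] (deg G a * 𝟙 (deg G a ≟ j))    ≡⟨ sum-cong-≗ (λ a → *𝟙-cong (deg G a ≟ j) (λ eq → eq)) ⟩
    ∑[ a < n ] (j * 𝟙 (deg G a ≟ j))          ≡⟨ sym (*-distribˡ-sum j (λ a → 𝟙 (deg G a ≟ j))) ⟩
    j * deg= G j                              ∎
    where
    open ≡-Reasoning

  markov : ∀ G c {f : Fin n → ℕ} → (∀ a → c * f a ≤ deg G a) → c * sum f ≤ degSum G
  markov G c {f} h = begin
    c * sum f              ≡⟨ *-distribˡ-sum c f ⟩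
    ∑[ a < n ] (c * f a)   ≤⟨ sum-mono h ⟩
    sum (deg G)            ≡⟨ sym (degSum≡∑ G) ⟩
    degSum G               ∎
    where open ≤-Reasoning

  deg=-markov : ∀ G j → j * deg= G j ≤ degSum G
  deg=-markov G j = markov G j (λ a → *𝟙≤ (deg G a ≟ j) (λ eq → ≤-reflexive (sym eq)))

  deg≥-markov : ∀ G j → j * deg≥ G j ≤ degSum G
  deg≥-markov G j = markov G j (λ a → *𝟙≤ (j ≤? deg G a) (λ le → le))

  sum₂ : (Fin n → Fin n → ℕ) → ℕ
  sum₂ f = ∑[ b < n ] ∑[ a < n ] f a b

  sum₂-mono : ∀ {f g} → (∀ a b → f a b ≤ g a b) → sum₂ f ≤ sum₂ g
  sum₂-mono h = sum-mono (λ b → sum-mono (λ a → h a b))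

  sum₂-+ : ∀ f g → sum₂ (λ a b → f a b + g a b) ≡ sum₂ f + sum₂ g
  sum₂-+ f g = trans (sum-cong-≗ (λ b → ∑-distrib-+ (λ a → f a b) (λ a → g a b))) (∑-distrib-+ (λ b → ∑[ a < n ] f a b) _)

  sum₂-permute : ∀ f (π : Permutation n n) → sum₂ (λ a b → f (π ⟨$⟩ʳ a) (π ⟨$⟩ʳ b)) ≡ sum₂ f
  sum₂-permute f π = trans (sum-cong-≗ (λ b → sym (sum-permute (λ a → f a (π ⟨$⟩ʳ b)) π))) (sym (sum-permute (λ b → ∑[ a < n ] f a b) π))

  -- At most `deg G v` neighbours of `v` qualify, each lying in at most `c` pairs. This bounds the
  -- pairs disturbed by deleting `v`.
  sum₂-nbrs : ∀ G v c → sum₂ (λ a b → e G a b * (e G a v * 𝟙 (deg G a ≤? c))) ≤ deg G v * c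
  sum₂-nbrs G v c = begin
    sum₂ (λ a b → e G a b * (e G a v * 𝟙 (deg G a ≤? c)))   ≡⟨ ∑∑-e G _ ⟩
    ∑[ a < n ] (deg G a * (e G a v * 𝟙 (deg G a ≤? c)))     ≤⟨ sum-mono pointwise ⟩
    ∑[ a < n ] (e G v a * c)                                ≡⟨ sym (*-distribʳ-sum c (e G v)) ⟩
    sum (e G v) * c                                         ≡⟨ cong (_* c) (sym (deg≡∑ G v)) ⟩
    deg G v * c                                             ∎
    where
    open ≤-Reasoning
    pointwise : ∀ a → deg G a * (e G a v * 𝟙 (deg G a ≤? c)) ≤ e G v a * c
    pointwise a = begin
      deg G a * (e G a v * 𝟙 (deg G a ≤? c)) ≡⟨ p (deg G a) (e G a v) (𝟙 (deg G a ≤? c)) ⟩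
      e G a v * (deg G a * 𝟙 (deg G a ≤? c)) ≤⟨ *-mono-≤ (≤-reflexive (e-sym G a v)) (*𝟙≤ (deg G a ≤? c) (λ le → le)) ⟩
      e G v a * c                            ∎
      where
      p : ∀ x y z → x * (y * z) ≡ y * (x * z)
      p = solve-∀

  -- The restriction deg b < T bounds by T what a vertex b without a known card contributes.
  pairs : Graph n → ℕ → ℕ → ℕ
  pairs G T j = sum₂ (λ a b → e G a b * (𝟙 (deg G b <? T) * 𝟙 (deg G a ≟ j)))

  pairs≡∑N : ∀ G T j → pairs G T j ≡ ∑[ b < n ] (𝟙 (deg G b <? T) * N G j b)
  pairs≡∑N G T j = sum-cong-≗ (λ b → trans (sum-cong-≗ (λ a → p (e G a b) (𝟙 (deg G b <? T)) (𝟙 (deg G a ≟ j))))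
                                           (sym (*-distribˡ-sum (𝟙 (deg G b <? T)) (λ a → e G a b * 𝟙 (deg G a ≟ j)))))
    where
    p : ∀ x y z → x * (y * z) ≡ y * (x * z)
    p = solve-∀

  -- Comparing counts through one common card

  module _ {G H : Graph n} {v : Fin n} (s : SameCard G H v) where
    open CardIdentities s

    -- If `a` is not `v` and its image is not adjacent to `v` in H, the degree of the image is at
    -- most `deg G a`. The exceptions are `v` itself and `deg H v` neighbours.
    deg<-card : ∀ j → deg< G j ≤ deg< H j + suc (deg H v)
    deg<-card j = begin
      deg< G j
        ≤⟨ sum-mono pointwise ⟩
      ∑[ a < n ] (𝟙 (deg H (t a) <? j) + (𝟙 (a Fin.≟ v) * 1 + e H (t a) v))
        ≡⟨ trans (∑-distrib-+ (λ a → 𝟙 (deg H (t a) <? j)) _) (cong (∑[ a < n ] 𝟙 (deg H (t a) <? j) +_) (∑-distrib-+ (λ a → 𝟙 (a Fin.≟ v) * 1) _)) ⟩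
      ∑[ a < n ] 𝟙 (deg H (t a) <? j) + (∑[ a < n ] (𝟙 (a Fin.≟ v) * 1) + ∑[ a < n ] e H (t a) v)
        ≡⟨ cong₂ _+_ (sym (sum-permute (λ a → 𝟙 (deg H a <? j)) τ))
             (cong₂ _+_ (sum-δ v (λ _ → 1)) (trans (sym (sum-permute (λ a → e H a v) τ)) (trans (sum-cong-≗ (λ a → e-sym H a v)) (sym (deg≡∑ H v))))) ⟩
      deg< H j + suc (deg H v) ∎
      where
      open ≤-Reasoning
      pointwise : ∀ a → 𝟙 (deg G a <? j) ≤ 𝟙 (deg H (t a) <? j) + (𝟙 (a Fin.≟ v) * 1 + e H (t a) v)
      pointwise a = 𝟙≤ (deg G a <? j) λ p<j → positive p<j
        where
        positive : deg G a < j → 1 ≤ 𝟙 (deg H (t a) <? j) + (𝟙 (a Fin.≟ v) * 1 + e H (t a) v)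
        positive p<j with a Fin.≟ v
        ... | yes _ = m≤n⇒m≤o+n (𝟙 (deg H (t a) <? j)) (s≤s z≤n)
        ... | no a≢v with e H (t a) v | deg-card a≢v
        ...   | suc y | _ = m≤n⇒m≤o+n (𝟙 (deg H (t a) <? j)) (s≤s z≤n)
        ...   | zero | eq = ≤-trans (≤-reflexive (sym (𝟙-yes (deg H (t a) <? j)
                  (≤-<-trans (≤-trans (m≤m+n _ _) (≤-reflexive (trans eq (+-identityʳ _)))) p<j)))) (m≤m+n _ 0)

    module _ (deg≡ : deg G v ≡ deg H v) where

      -- Equal degrees at `v` make `deg-card` hold at `a = v` too, so it can be used in sums over
      -- all vertices.
      deg-card′ : ∀ a → deg H (t a) + e G a v ≡ deg G a + e H (t a) v
      deg-card′ a with a Fin.≟ v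
      ... | yes refl rewrite fixes | e-irrefl G v | e-irrefl H v = cong (_+ 0) (sym deg≡)
      ... | no a≢v = deg-card a≢v

      -- The identity for Δ(j) in additive form, obtained by summing `𝟙-≥-card` over all vertices.
      deg≥-card : ∀ j → deg≥ G j + N H j v ≡ deg≥ H j + N G j v
      deg≥-card j = begin
        deg≥ G j + N H j v
          ≡⟨ cong (deg≥ G j +_) (sum-permute (λ a → e H a v * 𝟙 (deg H a ≟ j)) τ) ⟩
        deg≥ G j + ∑[ a < n ] (e H (t a) v * 𝟙 (deg H (t a) ≟ j))
          ≡⟨ sym (∑-distrib-+ (λ a → 𝟙 (j ≤? deg G a)) _) ⟩
        ∑[ a < n ] (𝟙 (j ≤? deg G a) + e H (t a) v * 𝟙 (deg H (t a) ≟ j))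
          ≡⟨ sum-cong-≗ (λ a → 𝟙-≥-card j (deg G a) (deg H (t a)) (adj G a v) (adj H (t a) v) (deg-card′ a)) ⟩
        ∑[ a < n ] (𝟙 (j ≤? deg H (t a)) + e G a v * 𝟙 (deg G a ≟ j))
          ≡⟨ ∑-distrib-+ (λ a → 𝟙 (j ≤? deg H (t a))) _ ⟩
        ∑[ a < n ] 𝟙 (j ≤? deg H (t a)) + N G j v
          ≡⟨ cong (_+ N G j v) (sym (sum-permute (λ a → 𝟙 (j ≤? deg H a)) τ)) ⟩
        deg≥ H j + N G j v ∎
        where open ≡-Reasoning

      -- A pair of G is kept in H unless `a = v` (`E₁`), `b = v` (`E₂`), `a` is adjacent to `v` in G
      -- (`E₃`), or the image of `a` or of `b` is adjacent to `v` in H (`E₄`, `E₅`). These cost `D`,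
      -- `D`, `D * j`, `D * suc j` and `D * T`, where `D` is `deg G v`.
      pairs-card : ∀ T j → pairs G T j ≤ pairs H T j + deg G v * (2 * j + T + 3)
      pairs-card T j = begin
        pairs G T j
          ≤⟨ sum₂-mono pointwise ⟩
        sum₂ (λ a b → kept a b + (E₁ a b + (E₂ a b + (E₃ a b + (E₄ a b + E₅ a b)))))
          ≡⟨ split ⟩
        sum₂ kept + (sum₂ E₁ + (sum₂ E₂ + (sum₂ E₃ + (sum₂ E₄ + sum₂ E₅))))
          ≤⟨ +-mono-≤ (≤-reflexive (sum₂-permute _ τ)) (+-mono-≤ (≤-reflexive ∑E₁) (+-mono-≤ (≤-reflexive ∑E₂)
               (+-mono-≤ (sum₂-nbrs G v j) (+-mono-≤ ∑E₄ ∑E₅)))) ⟩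
        pairs H T j + (deg G v + (deg G v + (deg G v * j + (deg G v * suc j + deg G v * T))))
          ≡⟨ cong (pairs H T j +_) (p (deg G v) j T) ⟩
        pairs H T j + deg G v * (2 * j + T + 3) ∎
        where
        open ≤-Reasoning
        p : ∀ D j T → D + (D + (D * j + (D * suc j + D * T))) ≡ D * (2 * j + T + 3)
        p = solve-∀
        kept E₁ E₂ E₃ E₄ E₅ : Fin n → Fin n → ℕ
        kept a b = e H (t a) (t b) * (𝟙 (deg H (t b) <? T) * 𝟙 (deg H (t a) ≟ j))
        E₁ a b = 𝟙 (a Fin.≟ v) * e G a b
        E₂ a b = 𝟙 (b Fin.≟ v) * e G a b
        E₃ a b = e G a b * (e G a v * 𝟙 (deg G a ≤? j))
        E₄ a b = e H (t a) (t b) * (e H (t a) v * 𝟙 (deg H (t a) ≤? suc j))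
        E₅ a b = e H (t a) (t b) * (e H (t b) v * 𝟙 (deg H (t b) ≤? T))

        split : sum₂ (λ a b → kept a b + (E₁ a b + (E₂ a b + (E₃ a b + (E₄ a b + E₅ a b))))) ≡
                sum₂ kept + (sum₂ E₁ + (sum₂ E₂ + (sum₂ E₃ + (sum₂ E₄ + sum₂ E₅))))
        split = trans (sum₂-+ kept _) (cong (sum₂ kept +_) (trans (sum₂-+ E₁ _) (cong (sum₂ E₁ +_)
               (trans (sum₂-+ E₂ _) (cong (sum₂ E₂ +_) (trans (sum₂-+ E₃ _) (cong (sum₂ E₃ +_) (sum₂-+ E₄ E₅))))))))

        ∑E₁ : sum₂ E₁ ≡ deg G v
        ∑E₁ = trans (sum-cong-≗ (λ b → sum-δ v (λ a → e G a b))) (sym (deg≡∑ G v))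

        ∑E₂ : sum₂ E₂ ≡ deg G v
        ∑E₂ = trans (∑-comm (λ b a → E₂ a b))
                (trans (sum-cong-≗ (λ a → trans (sum-δ v (e G a)) (e-sym G a v))) (sym (deg≡∑ G v)))

        ∑E₄ : sum₂ E₄ ≤ deg G v * suc j
        ∑E₄ = begin
          sum₂ E₄         ≡⟨ sum₂-permute (λ a b → e H a b * (e H a v * 𝟙 (deg H a ≤? suc j))) τ ⟩
          _               ≤⟨ sum₂-nbrs H v (suc j) ⟩
          deg H v * suc j ≡⟨ cong (_* suc j) (sym deg≡) ⟩
          deg G v * suc j ∎

        ∑E₅ : sum₂ E₅ ≤ deg G v * T
        ∑E₅ = begin
          sum₂ E₅     ≡⟨ sum₂-permute (λ a b → e H a b * (e H b v * 𝟙 (deg H b ≤? T))) τ ⟩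
          _           ≡⟨ ∑-comm (λ b a → e H a b * (e H b v * 𝟙 (deg H b ≤? T))) ⟩
          _           ≡⟨ sum-cong-≗ (λ a → sum-cong-≗ (λ b → cong (_* (e H b v * 𝟙 (deg H b ≤? T))) (e-sym H a b))) ⟩
          _           ≤⟨ sum₂-nbrs H v T ⟩
          deg H v * T ≡⟨ cong (_* T) (sym deg≡) ⟩
          deg G v * T ∎

        -- Adjacency of `b` to `v` in G alone does no harm, since it only lowers the degree of `b`
        -- in H and keeps it below `T`. In H a degree can be one larger, whence the caps `suc j` for
        -- `a` and `T` for `b`.
        survives : ∀ p q p′ q′ x y x′ y′ → q + bit x ≡ p + bit y → q′ + bit x′ ≡ p′ + bit y′ → p′ < T → p ≡ j →
          1 ≤ 𝟙 (q′ <? T) * 𝟙 (q ≟ j) + (bit x * 𝟙 (p ≤? j) + (bit y * 𝟙 (q ≤? suc j) + bit y′ * 𝟙 (q′ ≤? T)))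
        survives p q p′ q′ true y x′ y′ eq eq′ p′<T refl rewrite 𝟙-yes (p ≤? p) ≤-refl =
          m≤n⇒m≤o+n (𝟙 (q′ <? T) * 𝟙 (q ≟ p)) (s≤s z≤n)
        survives p q p′ q′ false true x′ y′ eq eq′ p′<T refl
          rewrite 𝟙-yes (q ≤? suc p) (≤-reflexive (trans (sym (+-identityʳ q)) (trans eq (+-comm p 1)))) =
          m≤n⇒m≤o+n (𝟙 (q′ <? T) * 𝟙 (q ≟ p)) (s≤s z≤n)
        survives p q p′ q′ false false x′ true eq eq′ p′<T refl
          rewrite 𝟙-yes (q′ ≤? T) (≤-trans (m≤m+n q′ _) (≤-trans (≤-reflexive (trans eq′ (+-comm p′ 1))) p′<T)) =
          m≤n⇒m≤o+n (𝟙 (q′ <? T) * 𝟙 (q ≟ p)) (s≤s z≤n)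
        survives p q p′ q′ false false x′ false eq eq′ p′<T refl
          rewrite 𝟙-yes (q ≟ p) (+-cancelʳ-≡ 0 q p eq)
                | 𝟙-yes (q′ <? T) (≤-<-trans (≤-trans (m≤m+n q′ _) (≤-reflexive (trans eq′ (+-identityʳ p′)))) p′<T) =
          s≤s z≤n

        pointwise : ∀ a b → e G a b * (𝟙 (deg G b <? T) * 𝟙 (deg G a ≟ j)) ≤
                    kept a b + (E₁ a b + (E₂ a b + (E₃ a b + (E₄ a b + E₅ a b))))
        pointwise a b with a Fin.≟ v | b Fin.≟ v
        ... | yes _ | _ = m≤n⇒m≤o+n (kept a b) (m≤n⇒m≤n+o _ (≤-trans edge (m≤m+n _ 0)))
          where
          edge : e G a b * (𝟙 (deg G b <? T) * 𝟙 (deg G a ≟ j)) ≤ e G a b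
          edge = ≤-trans (*-monoʳ-≤ (e G a b) (𝟙*𝟙≤ (deg G b <? T) (deg G a ≟ j) (λ _ _ → ≤-refl))) (≤-reflexive (*-identityʳ _))
        ... | no _ | yes _ = m≤n⇒m≤o+n (kept a b) (m≤n⇒m≤n+o _ (≤-trans edge (m≤m+n _ 0)))
          where
          edge : e G a b * (𝟙 (deg G b <? T) * 𝟙 (deg G a ≟ j)) ≤ e G a b
          edge = ≤-trans (*-monoʳ-≤ (e G a b) (𝟙*𝟙≤ (deg G b <? T) (deg G a ≟ j) (λ _ _ → ≤-refl))) (≤-reflexive (*-identityʳ _))
        ... | no a≢v | no b≢v rewrite e-iso a≢v b≢v = begin
          E * _
            ≤⟨ *-monoʳ-≤ E (𝟙*𝟙≤ (deg G b <? T) (deg G a ≟ j)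
                 (survives (deg G a) (deg H (t a)) (deg G b) (deg H (t b)) (adj G a v) (adj H (t a) v) (adj G b v) (adj H (t b) v)
                   (deg-card′ a) (deg-card′ b))) ⟩
          E * (𝟙 (deg H (t b) <? T) * 𝟙 (deg H (t a) ≟ j) + (e G a v * 𝟙 (deg G a ≤? j) +
            (e H (t a) v * 𝟙 (deg H (t a) ≤? suc j) + e H (t b) v * 𝟙 (deg H (t b) ≤? T))))
            ≡⟨ q E (𝟙 (deg H (t b) <? T) * 𝟙 (deg H (t a) ≟ j)) (e G a v * 𝟙 (deg G a ≤? j))
                   (e H (t a) v * 𝟙 (deg H (t a) ≤? suc j)) (e H (t b) v * 𝟙 (deg H (t b) ≤? T)) ⟩
          _ ∎
          where
          E : ℕ
          E = e G a b
          q : ∀ E w x y z → E * (w + (x + (y + z))) ≡ E * w + (E * x + (E * y + E * z))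
          q = solve-∀

-- The degree comparison

-- The cards of the vertices v with μ v ≡ 0 are known.
module PartialDeck (d k n C : ℕ) (1≤d : 1 ≤ d) (1≤k : 1 ≤ k) (200≤C : 200 ≤ C)
                   (C*K≤n : C * (d * d * d * k) ≤ n) (μ : Fin n → ℕ) (∑μ : sum μ ≡ k) where
  open Bounds d k n C 1≤d 1≤k 200≤C C*K≤n
  open ≤-Reasoning

  sum-present : ∀ {c} {f g : Fin n → ℕ} → (∀ v → μ v ≡ 0 → f v ≤ g v) → (∀ v → f v ≤ c) → sum f ≤ sum g + k * c
  sum-present {c} {f} {g} present bounded = ≤-trans (sum-except μ present bounded) (≤-reflexive (cong (λ x → sum g + x * c) ∑μ))

  low-vertex : ∀ G → degSum G ≤ d * n → ∃ λ v → μ v ≡ 0 × deg G v ≤ 2 * d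
  low-vertex G avg with any? (λ v → (μ v ≟ 0) ×-dec (deg G v ≤? 2 * d))
  ... | yes found = found
  ... | no none = contradiction (begin
    n * suc (2 * d)                  ≡⟨ sym (sum-const n (suc (2 * d))) ⟩
    ∑[ v < n ] suc (2 * d)           ≤⟨ sum-present (λ v μv≡0 → ≰⇒> (λ low → none (v , μv≡0 , low))) (λ _ → ≤-refl) ⟩
    sum (deg G) + k * suc (2 * d)    ≤⟨ +-monoˡ-≤ (k * suc (2 * d)) (≤-trans (≤-reflexive (sym (degSum≡∑ G))) avg) ⟩
    d * n + k * suc (2 * d)          ∎) low-vertex-bound

  degSum-≮ : ∀ {G H} → (∀ v → μ v ≡ 0 → SameCard G H v) → degSum G ≤ d * n → ¬ degSum G < degSum H
  degSum-≮ {G} {H} same avg ∑G<∑H with low-vertex G avg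
  -- The vertices of degree at most `2 * d` are many by the average degree (`n≤`) and few by
  -- climbing up from degree 0 (`deg<≤`).
  ... | v₀ , v₀-present , v₀-low = few-low-bound n≤ (deg<≤ (suc (2 * d)))
    where
    g<h : deg G v₀ ≤ deg H v₀
    g<h = *-cancelˡ-≤ 2 (+-cancelˡ-≤ (degSum G) _ _ (≤-trans (+-monoˡ-≤ _ (<⇒≤ ∑G<∑H))
            (≤-reflexive (CardIdentities.degSum-card (same v₀ v₀-present)))))
    c : ℕ
    c = deg H v₀ ∸ deg G v₀
    ∑H≡ : degSum H ≡ degSum G + 2 * c
    ∑H≡ = +-cancelʳ-≡ (2 * deg G v₀) _ _ (begin-equality
      degSum H + 2 * deg G v₀                 ≡⟨ CardIdentities.degSum-card (same v₀ v₀-present) ⟩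
      degSum G + 2 * deg H v₀                 ≡⟨ cong (λ x → degSum G + 2 * x) (sym (m∸n+n≡m g<h)) ⟩
      degSum G + 2 * (c + deg G v₀)           ≡⟨ p (degSum G) c (deg G v₀) ⟩
      degSum G + 2 * c + 2 * deg G v₀         ∎)
      where
      p : ∀ x c y → x + 2 * (c + y) ≡ x + 2 * c + 2 * y
      p = solve-∀
    1≤c : 1 ≤ c
    1≤c = n≢0⇒n>0 (λ c≡0 → <⇒≢ ∑G<∑H (sym (trans ∑H≡ (trans (cong (λ x → degSum G + 2 * x) c≡0) (+-identityʳ _)))))
    -- By `degSum-card`, twice the difference of the degrees at a known `v` is the difference of the
    -- degree sums, so the shift `c` read off at `v₀` is common to all.
    shifted : ∀ v → μ v ≡ 0 → deg H v ≡ deg G v + c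
    shifted v present = *-cancelˡ-≡ _ _ 2 (+-cancelˡ-≡ (degSum G) _ _ (begin-equality
      degSum G + 2 * deg H v           ≡⟨ sym (CardIdentities.degSum-card (same v present)) ⟩
      degSum H + 2 * deg G v           ≡⟨ cong (_+ 2 * deg G v) ∑H≡ ⟩
      degSum G + 2 * c + 2 * deg G v   ≡⟨ p (degSum G) c (deg G v) ⟩
      degSum G + 2 * (deg G v + c)     ∎))
      where
      p : ∀ x c y → x + 2 * c + 2 * y ≡ x + 2 * (y + c)
      p = solve-∀
    -- All known degrees in H are at least `c`, while `degSum H` exceeds `degSum G` by just `2 * c`.
    c≤2d : c ≤ 2 * d
    c≤2d = shift-bound (begin
      n * c                        ≡⟨ sym (sum-const n c) ⟩
      ∑[ v < n ] c                 ≤⟨ sum-present (λ v present → ≤-trans (m≤n+m c (deg G v)) (≤-reflexive (sym (shifted v present)))) (λ _ → ≤-refl) ⟩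
      sum (deg H) + k * c          ≡⟨ cong (_+ k * c) (trans (sym (degSum≡∑ H)) ∑H≡) ⟩
      degSum G + 2 * c + k * c     ≤⟨ +-monoˡ-≤ (k * c) (+-monoˡ-≤ (2 * c) avg) ⟩
      d * n + 2 * c + k * c        ≡⟨ p (d * n) k c ⟩
      d * n + (k + 2) * c          ∎)
      where
      p : ∀ x k c → x + 2 * c + k * c ≡ x + (k + 2) * c
      p = solve-∀
    degHv₀≤4d : deg H v₀ ≤ 4 * d
    degHv₀≤4d = begin
      deg H v₀      ≡⟨ shifted v₀ v₀-present ⟩
      deg G v₀ + c  ≤⟨ +-mono-≤ v₀-low c≤2d ⟩
      2 * d + 2 * d ≡⟨ p d ⟩
      4 * d         ∎
      where
      p : ∀ d → 2 * d + 2 * d ≡ 4 * d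
      p = solve-∀
    -- The card at `v₀` leads from G to H at the same level; the shift by `c ≥ 1` then leads back to
    -- G one level lower.
    deg<-suc : ∀ j → deg< G (suc j) ≤ deg< G j + (k + suc (4 * d))
    deg<-suc j = begin
      deg< G (suc j)                         ≤⟨ deg<-card (same v₀ v₀-present) (suc j) ⟩
      deg< H (suc j) + suc (deg H v₀)        ≤⟨ +-mono-≤ (sum-present present (λ v → 𝟙≤ (deg H v <? suc j) (λ _ → ≤-refl))) (s≤s degHv₀≤4d) ⟩
      deg< G j + k * 1 + suc (4 * d)         ≡⟨ trans (cong (λ x → deg< G j + x + suc (4 * d)) (*-identityʳ k)) (+-assoc (deg< G j) k _) ⟩
      deg< G j + (k + suc (4 * d))           ∎
      where
      present : ∀ v → μ v ≡ 0 → 𝟙 (deg H v <? suc j) ≤ 𝟙 (deg G v <? j)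
      present v μv≡0 = 𝟙≤ (deg H v <? suc j) (λ h<1+j → ≤-reflexive (sym (𝟙-yes (deg G v <? j) (begin
        suc (deg G v) ≡⟨ +-comm 1 _ ⟩
        deg G v + 1   ≤⟨ +-monoʳ-≤ (deg G v) 1≤c ⟩
        deg G v + c   ≡⟨ sym (shifted v μv≡0) ⟩
        deg H v       ≤⟨ ≤-pred h<1+j ⟩
        j             ∎))))
    deg<≤ : ∀ j → deg< G j ≤ j * (k + suc (4 * d))
    deg<≤ zero = begin
      deg< G 0      ≤⟨ sum-mono (λ v → 𝟙≤ (deg G v <? 0) (λ ())) ⟩
      ∑[ v < n ] 0  ≡⟨ trans (sum-const n 0) (*-zeroʳ n) ⟩
      0             ∎
    deg<≤ (suc j) = ≤-trans (deg<-suc j) (≤-trans (+-monoˡ-≤ _ (deg<≤ j)) (≤-reflexive (+-comm (j * (k + suc (4 * d))) _)))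
    n≤ : n * suc (2 * d) ≤ suc (2 * d) * deg< G (suc (2 * d)) + d * n
    n≤ = begin
      n * suc (2 * d)
        ≡⟨ sym (sum-const n (suc (2 * d))) ⟩
      ∑[ v < n ] suc (2 * d)
        ≤⟨ sum-mono pointwise ⟩
      ∑[ v < n ] (suc (2 * d) * 𝟙 (deg G v <? suc (2 * d)) + deg G v)
        ≡⟨ ∑-distrib-+ (λ v → suc (2 * d) * 𝟙 (deg G v <? suc (2 * d))) (deg G) ⟩
      ∑[ v < n ] (suc (2 * d) * 𝟙 (deg G v <? suc (2 * d))) + sum (deg G)
        ≤⟨ +-mono-≤ (≤-reflexive (sym (*-distribˡ-sum (suc (2 * d)) (λ v → 𝟙 (deg G v <? suc (2 * d))))))
                    (≤-trans (≤-reflexive (sym (degSum≡∑ G))) avg) ⟩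
      suc (2 * d) * deg< G (suc (2 * d)) + d * n ∎
      where
      pointwise : ∀ v → suc (2 * d) ≤ suc (2 * d) * 𝟙 (deg G v <? suc (2 * d)) + deg G v
      pointwise v with <-≤-connex (deg G v) (suc (2 * d))
      ... | inj₁ lt = ≤-trans (≤-reflexive (sym (trans (cong (suc (2 * d) *_) (𝟙-yes (deg G v <? suc (2 * d)) lt)) (*-identityʳ _)))) (m≤m+n _ (deg G v))
      ... | inj₂ ge = ≤-trans ge (m≤n+m (deg G v) _)

  module _ {G H : Graph n} (same : ∀ v → μ v ≡ 0 → SameCard G H v) (∑G≡∑H : degSum G ≡ degSum H) (avg : degSum G ≤ d * n) where

    deg-present : ∀ v → μ v ≡ 0 → deg G v ≡ deg H v
    deg-present v present = *-cancelˡ-≡ _ _ 2 (+-cancelˡ-≡ (degSum G) _ _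
      (trans (cong (_+ 2 * deg G v) ∑G≡∑H) (CardIdentities.degSum-card (same v present))))

    avgH : degSum H ≤ d * n
    avgH = ≤-trans (≤-reflexive (sym ∑G≡∑H)) avg

    -- Degrees close to n are excluded by comparing one level lower, at i: every known v
    -- then has fewer than deg= H i neighbours of degree i in H, although a vertex of
    -- degree i is adjacent to almost everything.
    deg≥-≯ : ∀ i → suc i ≤ n → deg≥ G (suc (suc i)) ≡ deg≥ H (suc (suc i)) → ¬ deg≥ H (suc i) < deg≥ G (suc i)
    deg≥-≯ i 1+i≤n above excess with m≤n⇒∃[o]m+o≡n excess | low-vertex G avg
    -- The split is whether `i` lies within n/(20d) of `n`.
    ... | δ′ , δ-eq | v₀ , v₀-present , v₀-low with 20 * d * (n ∸ i) ≤? n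
    ...   | yes close = near-top (m+[n∸m]≡n (<⇒≤ 1+i≤n)) close below-j (≤-trans (deg=-markov H i) avgH)
      where
      below-j : n + i * deg= H i ≤ n * deg= H i + k * suc (deg= H i)
      below-j = begin
        n + i * deg= H i                              ≡⟨ cong₂ _+_ (sym (trans (sum-const n 1) (*-identityʳ n))) (sym (∑N H i)) ⟩
        ∑[ v < n ] 1 + sum (N H i)                    ≡⟨ sym (∑-distrib-+ (λ (v : Fin n) → 1) (N H i)) ⟩
        ∑[ v < n ] suc (N H i v)                      ≤⟨ sum-present present (λ v → s≤s (N≤deg= H i v)) ⟩
        ∑[ v < n ] deg= H i + k * suc (deg= H i)      ≡⟨ cong (_+ k * suc (deg= H i)) (sum-const n (deg= H i)) ⟩
        n * deg= H i + k * suc (deg= H i)             ∎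
        where
        -- In `deg≥-card` at level `i`, the vertices of degree `i` in G make up for `N G i v`, and
        -- the excess at `suc i` contributes the extra one.
        present : ∀ v → μ v ≡ 0 → suc (N H i v) ≤ deg= H i
        present v μv≡0 = +-cancelˡ-≤ (deg≥ H (suc i) + N G i v) _ _ (begin
          deg≥ H (suc i) + N G i v + suc (N H i v)   ≡⟨ p (deg≥ H (suc i)) (N G i v) (N H i v) ⟩
          suc (deg≥ H (suc i)) + N G i v + N H i v   ≤⟨ +-monoˡ-≤ (N H i v) (+-mono-≤ excess (N≤deg= G i v)) ⟩
          deg≥ G (suc i) + deg= G i + N H i v        ≡⟨ cong (_+ N H i v) (sym (deg≥-suc G i)) ⟩
          deg≥ G i + N H i v                         ≡⟨ deg≥-card (same v μv≡0) (deg-present v μv≡0) i ⟩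
          deg≥ H i + N G i v                         ≡⟨ cong (_+ N G i v) (deg≥-suc H i) ⟩
          deg≥ H (suc i) + deg= H i + N G i v        ≡⟨ q (deg≥ H (suc i)) (deg= H i) (N G i v) ⟩
          deg≥ H (suc i) + N G i v + deg= H i        ∎)
          where
          p : ∀ x y z → x + y + suc z ≡ suc x + y + z
          p = solve-∀
          q : ∀ x y z → x + y + z ≡ x + z + y
          q = solve-∀
    ...   | no far = low-bound {F = pairs G T j} {F′ = pairs H T j} j≤4dk v₀-low few-high fewer-pairs
                       (pairs-card (same v₀ v₀-present) (deg-present v₀ v₀-present) T j)
      where
      j T δ r h : ℕ
      j = suc i
      -- With average degree at most `d`, at most n/4 vertices reach degree `4 * d`; the remaining
      -- ones yield the linear gain of pairs.
      T = 4 * d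
      δ = suc δ′
      r = n ∸ j
      h = deg= H j

      j+r≡n : j + r ≡ n
      j+r≡n = m+[n∸m]≡n 1+i≤n

      deg≥δ : deg≥ G j ≡ deg≥ H j + δ
      deg≥δ = trans (sym δ-eq) (sym (+-suc _ δ′))

      -- The counts above `j` agree, so the surplus `δ` lies at degree exactly `j`.
      deg=δ : deg= G j ≡ h + δ
      deg=δ = +-cancelˡ-≡ (deg≥ H (suc j)) _ _ (begin-equality
        deg≥ H (suc j) + deg= G j   ≡⟨ cong (_+ deg= G j) (sym above) ⟩
        deg≥ G (suc j) + deg= G j   ≡⟨ sym (deg≥-suc G j) ⟩
        deg≥ G j                    ≡⟨ deg≥δ ⟩
        deg≥ H j + δ                ≡⟨ cong (_+ δ) (deg≥-suc H j) ⟩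
        deg≥ H (suc j) + h + δ      ≡⟨ +-assoc (deg≥ H (suc j)) h δ ⟩
        deg≥ H (suc j) + (h + δ)    ∎)

      Nδ : ∀ v → μ v ≡ 0 → N G j v ≡ N H j v + δ
      Nδ v present = +-cancelˡ-≡ (deg≥ H j) _ _ (begin-equality
        deg≥ H j + N G j v        ≡⟨ sym (deg≥-card (same v present) (deg-present v present) j) ⟩
        deg≥ G j + N H j v        ≡⟨ cong (_+ N H j v) deg≥δ ⟩
        deg≥ H j + δ + N H j v    ≡⟨ p (deg≥ H j) δ (N H j v) ⟩
        deg≥ H j + (N H j v + δ)  ∎)
        where
        p : ∀ x y z → x + y + z ≡ x + (z + y)
        p = solve-∀

      -- Summing `Nδ` over `v` counts each vertex of degree `j` exactly `j` times; a missing card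
      -- costs at most `h + δ`.
      nδ≤ : n * δ ≤ j * δ + k * δ + k * h
      nδ≤ = +-cancelˡ-≤ (j * h) _ _ (begin
        j * h + n * δ                        ≡⟨ cong₂ _+_ (sym (∑N H j)) (sym (sum-const n δ)) ⟩
        sum (N H j) + ∑[ v < n ] δ           ≡⟨ sym (∑-distrib-+ (N H j) (λ _ → δ)) ⟩
        ∑[ v < n ] (N H j v + δ)             ≤⟨ sum-present (λ v present → ≤-reflexive (sym (Nδ v present))) (λ v → +-monoˡ-≤ δ (N≤deg= H j v)) ⟩
        sum (N G j) + k * (h + δ)            ≡⟨ cong (_+ k * (h + δ)) (trans (∑N G j) (cong (j *_) deg=δ)) ⟩
        j * (h + δ) + k * (h + δ)            ≡⟨ p j h δ k ⟩
        j * h + (j * δ + k * δ + k * h)      ∎)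
        where
        p : ∀ j h δ k → j * (h + δ) + k * (h + δ) ≡ j * h + (j * δ + k * δ + k * h)
        p = solve-∀

      -- `n ∸ i` is one more than `r`, so the failed test at `i` speaks of `suc r`.
      n<20d1+r : n < 20 * d * suc r
      n<20d1+r = <-≤-trans (≰⇒> far) (≤-reflexive (cong (20 * d *_) (+-∸-assoc 1 1+i≤n)))

      j≤4dk : j ≤ 4 * (d * k)
      j≤4dk = far-from-top j+r≡n n<20d1+r (gap-bound {δ = δ} (s≤s z≤n) j+r≡n n<20d1+r nδ≤) (≤-trans (deg=-markov H j) avgH)

      few-high : 4 * deg≥ G T ≤ n
      few-high = *-cancelˡ-≤ d {{>-nonZero 1≤d}} (begin
        d * (4 * deg≥ G T)   ≡⟨ p d (deg≥ G T) ⟩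
        T * deg≥ G T         ≤⟨ deg≥-markov G T ⟩
        degSum G             ≤⟨ avg ⟩
        d * n                ∎)
        where
        p : ∀ d x → d * (4 * x) ≡ 4 * d * x
        p = solve-∀

      -- By `Nδ`, a known vertex of degree below `T` is in at least one more pair in G. Degrees of
      -- at least `T` are paid for by `deg≥ G T`, missing cards by `suc T` each.
      fewer-pairs : pairs H T j + n ≤ pairs G T j + k * suc T + deg≥ G T
      fewer-pairs = begin
        pairs H T j + n
          ≡⟨ cong₂ _+_ (pairs≡∑N H T j) (sym (trans (sum-const n 1) (*-identityʳ n))) ⟩
        ∑[ v < n ] (𝟙 (deg H v <? T) * N H j v) + ∑[ v < n ] 1
          ≡⟨ sym (∑-distrib-+ (λ v → 𝟙 (deg H v <? T) * N H j v) (λ _ → 1)) ⟩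
        ∑[ v < n ] (𝟙 (deg H v <? T) * N H j v + 1)
          ≤⟨ sum-present present bounded ⟩
        ∑[ v < n ] (𝟙 (deg G v <? T) * N G j v + 𝟙 (T ≤? deg G v)) + k * suc T
          ≡⟨ cong (_+ k * suc T) (trans (∑-distrib-+ (λ v → 𝟙 (deg G v <? T) * N G j v) (λ v → 𝟙 (T ≤? deg G v)))
                (cong (_+ deg≥ G T) (sym (pairs≡∑N G T j)))) ⟩
        pairs G T j + deg≥ G T + k * suc T
          ≡⟨ p (pairs G T j) (deg≥ G T) (k * suc T) ⟩
        pairs G T j + k * suc T + deg≥ G T ∎
        where
        p : ∀ x y z → x + y + z ≡ x + z + y
        p = solve-∀
        bounded : ∀ v → 𝟙 (deg H v <? T) * N H j v + 1 ≤ suc T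
        bounded v = ≤-trans (+-monoˡ-≤ 1 (𝟙*≤ (deg H v <? T) (λ low → ≤-trans (N≤deg H j v) (<⇒≤ low)))) (≤-reflexive (+-comm T 1))
        split : ∀ D N₁ N₂ → suc N₁ ≤ N₂ → 𝟙 (D <? T) * N₁ + 1 ≤ 𝟙 (D <? T) * N₂ + 𝟙 (T ≤? D)
        split D N₁ N₂ N₁<N₂ with <-≤-connex D T
        ... | inj₁ lt rewrite 𝟙-yes (D <? T) lt = ≤-trans (≤-reflexive (trans (cong (_+ 1) (*-identityˡ N₁)) (+-comm N₁ 1)))
                (≤-trans N₁<N₂ (≤-trans (m≤m+n N₂ 0) (m≤m+n _ _)))
        ... | inj₂ ge rewrite 𝟙-yes (T ≤? D) ge | 𝟙-no (D <? T) (≤⇒≯ ge) = ≤-refl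
        present : ∀ v → μ v ≡ 0 → 𝟙 (deg H v <? T) * N H j v + 1 ≤ 𝟙 (deg G v <? T) * N G j v + 𝟙 (T ≤? deg G v)
        present v μv≡0 = ≤-trans (≤-reflexive (cong (λ x → 𝟙 (x <? T) * N H j v + 1) (sym (deg-present v μv≡0))))
          (split (deg G v) (N H j v) (N G j v) (≤-trans (m<m+n (N H j v) (s≤s z≤n)) (≤-reflexive (sym (Nδ v μv≡0)))))

-- From counts to degree sequences

sum≡0⇒≡0 : ∀ {n} {f : Fin n → ℕ} → sum f ≡ 0 → ∀ v → f v ≡ 0
sum≡0⇒≡0 {f = f} eq zero = m+n≡0⇒m≡0 (f zero) eq
sum≡0⇒≡0 {f = f} eq (suc v) = sum≡0⇒≡0 (m+n≡0⇒n≡0 (f zero) eq) v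

module _ {n : ℕ} where

  deg≥-beyond : ∀ (G : Graph n) {j} → n < j → deg≥ G j ≡ 0
  deg≥-beyond G {j} n<j = n≤0⇒n≡0 (begin
    deg≥ G j       ≤⟨ sum-mono (λ v → 𝟙≤ (j ≤? deg G v) (λ j≤deg → contradiction (≤-trans j≤deg (deg≤n G v)) (<⇒≱ n<j))) ⟩
    ∑[ v < n ] 0   ≡⟨ trans (sum-const n 0) (*-zeroʳ n) ⟩
    0              ∎)
    where open ≤-Reasoning

  -- Downward induction on `j`, with `deg≥-≯` applied in both directions. The complete deck is
  -- treated apart because `Bounds` takes `1 ≤ k`.
  deg≥-determined : ∀ {d C} {G H : Graph n} (μ : Fin n → ℕ) → 1 ≤ d → 3 ≤ n → 200 ≤ C →
                    C * (d * d * d * sum μ) ≤ n → degSum G ≤ d * n →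
                    (∀ v → μ v ≡ 0 → SameCard G H v) → ∀ j → deg≥ G j ≡ deg≥ H j
  deg≥-determined {d} {C} {G} {H} μ 1≤d 3≤n 200≤C C*K≤n avg same with sum μ in ∑μ
  ... | zero = λ j → sum-cong-≗ (λ v → cong (λ x → 𝟙 (j ≤? x)) (deg≡ v))
    where
    card-sums : ∀ v → degSum H + 2 * deg G v ≡ degSum G + 2 * deg H v
    card-sums v = CardIdentities.degSum-card (same v (sum≡0⇒≡0 ∑μ v))
    total : ∀ (F F′ : Graph n) → ∑[ v < n ] (degSum F + 2 * deg F′ v) ≡ n * degSum F + 2 * degSum F′
    total F F′ = trans (∑-distrib-+ (λ v → degSum F) (λ v → 2 * deg F′ v))
      (cong₂ _+_ (sum-const n (degSum F)) (trans (sym (*-distribˡ-sum 2 (deg F′))) (cong (2 *_) (sym (degSum≡∑ F′)))))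
    -- Summing `card-sums` over all `v` makes `n ∸ 2` times the difference of the degree sums
    -- vanish, and `3 ≤ n` makes that factor positive.
    ∑H≡∑G : degSum H ≡ degSum G
    ∑H≡∑G = *-cancelˡ-≡ (degSum H) (degSum G) (n ∸ 2) {{>-nonZero (m<n⇒0<n∸m 3≤n)}}
      (+-cancelʳ-≡ (2 * (degSum H + degSum G)) _ _ (begin
        (n ∸ 2) * degSum H + 2 * (degSum H + degSum G)   ≡⟨ p (n ∸ 2) (degSum H) (degSum G) ⟩
        (2 + (n ∸ 2)) * degSum H + 2 * degSum G          ≡⟨ cong (λ x → x * degSum H + 2 * degSum G) n≡ ⟩
        n * degSum H + 2 * degSum G                      ≡⟨ trans (sym (total H G)) (trans (sum-cong-≗ card-sums) (total G H)) ⟩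
        n * degSum G + 2 * degSum H                      ≡⟨ cong (λ x → x * degSum G + 2 * degSum H) (sym n≡) ⟩
        (2 + (n ∸ 2)) * degSum G + 2 * degSum H          ≡⟨ q (n ∸ 2) (degSum H) (degSum G) ⟩
        (n ∸ 2) * degSum G + 2 * (degSum H + degSum G)   ∎))
      where
      open ≡-Reasoning
      n≡ : 2 + (n ∸ 2) ≡ n
      n≡ = m+[n∸m]≡n (<⇒≤ 3≤n)
      p : ∀ m x y → m * x + 2 * (x + y) ≡ (2 + m) * x + 2 * y
      p = solve-∀
      q : ∀ m x y → (2 + m) * y + 2 * x ≡ m * y + 2 * (x + y)
      q = solve-∀
    deg≡ : ∀ v → deg G v ≡ deg H v
    deg≡ v = *-cancelˡ-≡ _ _ 2 (+-cancelˡ-≡ (degSum G) _ _ (trans (cong (_+ 2 * deg G v) (sym ∑H≡∑G)) (card-sums v)))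
  ... | suc k′ = λ j → descend (suc n) j (m≤m+n (suc n) j)
    where
    open PartialDeck d (suc k′) n C 1≤d (s≤s z≤n) 200≤C C*K≤n μ ∑μ

    same′ : ∀ v → μ v ≡ 0 → SameCard H G v
    same′ v = SameCard-sym ∘ same v

    ∑G≡∑H : degSum G ≡ degSum H
    ∑G≡∑H with <-cmp (degSum G) (degSum H)
    ... | tri< lt _ _ = contradiction lt (degSum-≮ same avg)
    ... | tri≈ _ eq _ = eq
    -- H has the smaller degree sum here, so it inherits the bound `d * n` and the roles can be
    -- exchanged.
    ... | tri> _ _ gt = contradiction gt (degSum-≮ same′ (≤-trans (<⇒≤ gt) avg))

    -- `t` is fuel: it bounds how far `j` lies below `suc n`, and no degree exceeds `n`.
    descend : ∀ t j → n < t + j → deg≥ G j ≡ deg≥ H j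
    descend zero j n<j = trans (deg≥-beyond G n<j) (sym (deg≥-beyond H n<j))
    descend (suc t) zero _ = refl
    descend (suc t) (suc i) n<t+j with suc i ≤? n
    ... | no n<j = trans (deg≥-beyond G (≰⇒> n<j)) (sym (deg≥-beyond H (≰⇒> n<j)))
    ... | yes j≤n with <-cmp (deg≥ G (suc i)) (deg≥ H (suc i)) | descend t (suc (suc i)) (≤-trans n<t+j (≤-reflexive (sym (+-suc t (suc i)))))
    ...   | tri< lt _ _ | above = contradiction lt (deg≥-≯ same′ (sym ∑G≡∑H) (avgH same ∑G≡∑H avg) i j≤n (sym above))
    ...   | tri≈ _ eq _ | _ = eq
    ...   | tri> _ _ gt | above = contradiction gt (deg≥-≯ same ∑G≡∑H avg i j≤n above)

-- Lists with equal multiplicities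

count : List ℕ → ℕ → ℕ
count xs x = ListAction.sum (map (λ y → 𝟙 (y ≟ x)) xs)

count>0⇒∈ : ∀ xs {x} → 1 ≤ count xs x → x ∈ₗ xs
count>0⇒∈ (y ∷ xs) {x} 1≤c with y ≟ x
... | yes y≡x = here (sym y≡x)
... | no y≢x = there (count>0⇒∈ xs (subst (λ c → 1 ≤ c + count xs x) (𝟙-no (y ≟ x) y≢x) 1≤c))

count-↭ : ∀ {xs ys} → xs ↭ ys → ∀ x → count xs x ≡ count ys x
count-↭ p x = sum-↭ (map⁺ (λ y → 𝟙 (y ≟ x)) p)

1≤count-head : ∀ x xs → 1 ≤ count (x ∷ xs) x
1≤count-head x xs = ≤-trans (≤-reflexive (sym (𝟙-yes (x ≟ x) refl))) (m≤m+n _ _)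

count-≗⇒↭ : ∀ xs ys → (∀ x → count xs x ≡ count ys x) → xs ↭ ys
count-≗⇒↭ [] [] h = ↭-refl
count-≗⇒↭ [] (y ∷ ys) h = contradiction (≤-trans (1≤count-head y ys) (≤-reflexive (sym (h y)))) λ ()
count-≗⇒↭ (x ∷ xs) ys h with ∈-∃++ (count>0⇒∈ ys (≤-trans (1≤count-head x xs) (≤-reflexive (h x))))
... | as , bs , refl = ↭-trans (prep x (count-≗⇒↭ xs (as ++ bs) (λ z →
        +-cancelˡ-≡ (𝟙 (x ≟ z)) _ _ (trans (h z) (count-↭ (shift x as bs) z))))) (↭-sym (shift x as bs))

count-degSeq : ∀ {n} (G : Graph n) j → count (degSeq G) j ≡ deg= G j
count-degSeq {n} G j = trans (cong ListAction.sum (sym (map-∘ (allFin n)))) (sum-map-allFin (λ a → 𝟙 (deg G a ≟ j)))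

-- Aligning the vertices of H with those of G

transpose-left : ∀ {n} (i j : Fin n) → transpose i j ⟨$⟩ʳ i ≡ j
transpose-left i j rewrite dec-true (i Fin.≟ i) refl = refl

transpose-other : ∀ {n} {i j k : Fin n} → k ≢ i → k ≢ j → transpose i j ⟨$⟩ʳ k ≡ k
transpose-other {i = i} {j} {k} k≢i k≢j rewrite dec-false (k Fin.≟ i) k≢i | dec-false (k Fin.≟ j) k≢j = refl

-- The vertices are treated one by one: for `x ∈ S`, a transposition moves the current image of `x`
-- to `f x`. Values fixed earlier stay, since they differ from that image and, by injectivity of
-- `f`, from `f x`.
extend-to-permutation : ∀ {n} (S : Subset n) (f : Fin n → Fin n) →
  (∀ v w → v ∈ S → w ∈ S → f v ≡ f w → v ≡ w) →
  ∃ λ (π : Permutation n n) → ∀ v → v ∈ S → π ⟨$⟩ʳ v ≡ f v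
extend-to-permutation {n} S f inj with go (allFin n)
  where
  go : ∀ xs → ∃ λ (π : Permutation n n) → ∀ v → v ∈ₗ xs → v ∈ S → π ⟨$⟩ʳ v ≡ f v
  go [] = Perm.id , λ v ()
  go (x ∷ xs) with go xs | x ∈? S
  ... | π , agrees | no x∉S = π , λ { v (here refl) v∈S → contradiction v∈S x∉S ; v (there v∈xs) v∈S → agrees v v∈xs v∈S }
  ... | π , agrees | yes x∈S = π ∘ₚ swap , agrees′
    where
    swap : Permutation n n
    swap = transpose (π ⟨$⟩ʳ x) (f x)
    agrees′ : ∀ v → v ∈ₗ (x ∷ xs) → v ∈ S → swap ⟨$⟩ʳ (π ⟨$⟩ʳ v) ≡ f v
    agrees′ v v∈ v∈S with v Fin.≟ x | v∈
    ... | yes refl | _ = transpose-left (π ⟨$⟩ʳ x) (f x)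
    ... | no v≢x | here v≡x = contradiction v≡x v≢x
    ... | no v≢x | there v∈xs = trans (transpose-other πv≢πx πv≢fx) (agrees v v∈xs v∈S)
      where
      πv≢πx : π ⟨$⟩ʳ v ≢ π ⟨$⟩ʳ x
      πv≢πx eq = v≢x (trans (sym (inverseˡ π)) (trans (cong (π ⟨$⟩ˡ_) eq) (inverseˡ π)))
      πv≢fx : π ⟨$⟩ʳ v ≢ f x
      πv≢fx eq = v≢x (inj v x v∈S x∈S (trans (sym (agrees v v∈xs v∈S)) eq))
... | π , agrees = π , λ v → agrees v (∈-allFin v)

relabel : ∀ {n} → Graph n → Permutation n n → Graph n
relabel H π = record
  { adj    = λ a b → adj H (π ⟨$⟩ʳ a) (π ⟨$⟩ʳ b)
  ; sym    = λ a b → adj-sym H (π ⟨$⟩ʳ a) (π ⟨$⟩ʳ b)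
  ; irrefl = λ a → irrefl H (π ⟨$⟩ʳ a)
  }

deg-relabel : ∀ {n} (H : Graph n) π a → deg (relabel H π) a ≡ deg H (π ⟨$⟩ʳ a)
deg-relabel H π a = trans (deg≡∑ (relabel H π) a) (trans (sym (sum-permute (e H (π ⟨$⟩ʳ a)) π)) (sym (deg≡∑ H (π ⟨$⟩ʳ a))))

deg=-relabel : ∀ {n} (H : Graph n) π j → deg= (relabel H π) j ≡ deg= H j
deg=-relabel H π j = trans (sum-cong-≗ (λ a → cong (λ x → 𝟙 (x ≟ j)) (deg-relabel H π a))) (sym (sum-permute (λ a → 𝟙 (deg H a ≟ j)) π))

insert-here : ∀ {m} (v w : Fin (suc m)) (σ : Permutation m m) → insert v w σ ⟨$⟩ʳ v ≡ w
insert-here v w σ with v Fin.≟ v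
... | yes _ = refl
... | no v≢v = contradiction refl v≢v

-- `insert` extends the isomorphism of the cards by sending `v` to `w`, and the inverse of `π` then
-- brings `w` back to `v`.
sameCard-relabel : ∀ {m} {G H : Graph (suc m)} {v} (π : Permutation (suc m) (suc m)) →
                   card G v ≅ card H (π ⟨$⟩ʳ v) → SameCard G (relabel H π) v
sameCard-relabel {m} {G} {H} {v} π (σ , σ-iso) = record
  { τ     = ρ ∘ₚ flip π
  ; fixes = trans (cong (π ⟨$⟩ˡ_) (insert-here v w σ)) (inverseˡ π)
  ; e-iso = λ {a} {b} a≢v b≢v → cong bit (begin
      adj H (π ⟨$⟩ʳ (π ⟨$⟩ˡ (ρ ⟨$⟩ʳ a))) (π ⟨$⟩ʳ (π ⟨$⟩ˡ (ρ ⟨$⟩ʳ b)))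
        ≡⟨ cong₂ (adj H) (trans (inverseʳ π) (ρ-other a≢v)) (trans (inverseʳ π) (ρ-other b≢v)) ⟩
      adj H (punchIn w (σ ⟨$⟩ʳ out a≢v)) (punchIn w (σ ⟨$⟩ʳ out b≢v))
        ≡⟨ σ-iso (out a≢v) (out b≢v) ⟩
      adj G (punchIn v (out a≢v)) (punchIn v (out b≢v))
        ≡⟨ cong₂ (adj G) (punchIn-punchOut _) (punchIn-punchOut _) ⟩
      adj G a b ∎)
  }
  where
  open ≡-Reasoning
  w : Fin (suc m)
  w = π ⟨$⟩ʳ v
  ρ : Permutation (suc m) (suc m)
  ρ = insert v w σ
  out : ∀ {a} → a ≢ v → Fin m
  out a≢v = punchOut {i = v} (a≢v ∘ sym)
  ρ-other : ∀ {a} (a≢v : a ≢ v) → ρ ⟨$⟩ʳ a ≡ punchIn w (σ ⟨$⟩ʳ out a≢v)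
  ρ-other a≢v = trans (cong (ρ ⟨$⟩ʳ_) (sym (punchIn-punchOut (a≢v ∘ sym)))) (insert-punchIn v w σ (out a≢v))

absent : ∀ {n} → Subset n → Fin n → ℕ
absent S v = if lookup S v then 0 else 1

∑-absent : ∀ {n} (S : Subset n) → sum (absent S) ≡ n ∸ ∣ S ∣
∑-absent {n} S = trans (sym (m+n∸n≡m (sum (absent S)) ∣ S ∣)) (cong (_∸ ∣ S ∣) (partition S))
  where
  partition : ∀ {n} (S : Subset n) → sum (absent S) + ∣ S ∣ ≡ n
  partition [] = refl
  partition (true ∷ S) = trans (+-suc _ _) (cong suc (partition S))
  partition (false ∷ S) = cong suc (partition S)

absent≡0⇒∈ : ∀ {n} (S : Subset n) v → absent S v ≡ 0 → v ∈ S
absent≡0⇒∈ S v eq with lookup S v in S[v]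
... | true = lookup⇒[]= v S S[v]

theorem1p1 : (d m : ℕ) → 1 ≤ d → 3 ≤ suc m → (G : Graph (suc m)) → degSum G ≤ d * suc m → (S : Subset (suc m)) → (suc m ∸ ∣ S ∣) * (10 ^ 4 * d ^ 3) ≤ suc m → (H : Graph (suc m)) → SubDeckIncluded G S H → SameDegreeSequence G H
theorem1p1 d m 1≤d 3≤n G avg S few H (f , f-inj , f-card) with extend-to-permutation S f f-inj
... | π , π≗f = count-≗⇒↭ (degSeq G) (degSeq H) (λ j → begin
    count (degSeq G) j     ≡⟨ count-degSeq G j ⟩
    deg= G j               ≡⟨ deg=-determined j ⟩
    deg= (relabel H π) j   ≡⟨ deg=-relabel H π j ⟩
    deg= H j               ≡⟨ sym (count-degSeq H j) ⟩
    count (degSeq H) j     ∎)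
  where
  open ≡-Reasoning
  same : ∀ v → absent S v ≡ 0 → SameCard G (relabel H π) v
  same v v-present = sameCard-relabel {G = G} {H} π (subst (λ w → card G v ≅ card H w) (sym (π≗f v v∈S)) (f-card v v∈S))
    where
    v∈S : v ∈ S
    v∈S = absent≡0⇒∈ S v v-present
  -- With `C` a variable, the ring solver does not meet the numeral `10 ^ 4`; the power `d ^ 3`
  -- unfolds to `d * (d * (d * 1))`.
  few-absent : ∀ C k n → k * (C * d ^ 3) ≤ n → sum (absent S) ≡ k → C * (d * d * d * sum (absent S)) ≤ n
  few-absent C k n bound refl = ≤-trans (≤-reflexive (p C d (sum (absent S)))) bound
    where
    p : ∀ C d k → C * (d * d * d * k) ≡ k * (C * (d * (d * (d * 1))))
    p = solve-∀
  deg≥≡ : ∀ j → deg≥ G j ≡ deg≥ (relabel H π) j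
  deg≥≡ = deg≥-determined (absent S) 1≤d 3≤n (toWitness {a? = 200 ≤? 10 ^ 4} _)
            (few-absent (10 ^ 4) (suc m ∸ ∣ S ∣) (suc m) few (∑-absent S)) avg same
  deg=-determined : ∀ j → deg= G j ≡ deg= (relabel H π) j
  deg=-determined j = +-cancelˡ-≡ (deg≥ G (suc j)) _ _ (begin
    deg≥ G (suc j) + deg= G j                              ≡⟨ sym (deg≥-suc G j) ⟩
    deg≥ G j                                               ≡⟨ deg≥≡ j ⟩
    deg≥ (relabel H π) j                                   ≡⟨ deg≥-suc (relabel H π) j ⟩
    deg≥ (relabel H π) (suc j) + deg= (relabel H π) j      ≡⟨ cong (_+ deg= (relabel H π) j) (sym (deg≥≡ (suc j))) ⟩
    deg≥ G (suc j) + deg= (relabel H π) j                  ∎)
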